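{- Assume that $(\lambda,\tau)$ is a threshold-tuple, and let $\sigma=\tau_{|\tau|}$ be the last element of $\tau$. Let $T,\mathcal B,y$ be the tree, the collection of processed subsets and the vector computed by $\mathtt{GP}(\lambda,\tau)$, and let $T',\mathcal B',y'$ be those computed by $\mathtt{GP}(\lambda,\widetilde\tau)$. Then $y=y'$ and (i) if $\sigma$ is an edge, then $\mathcal B=\mathcal B'$, $\sigma\notin E(T')$, and $T\subseteq T'+\sigma$; (ii) if $\sigma$ is a subset, then $T=T'$, $\sigma\notin\mathcal B'$, and $\mathcal B=\mathcal B'\cup\{\sigma\}$.
   Context: Instance: a finite connected undirected graph $G=(V,E)$, a root $r\in V$, an integer $0\le k\le|V|$, non-negative edge costs $c_e$, non-negative vertex penalties $\pi_v$ with $\pi_r=\infty$. For a potential $\lambda\ge0$ and $L\subseteq V$, $\pi^\lambda_L=\sum_{v\in L}\pi_v+\lambda|L|$. Let $y=(y_S)_{S\subseteq V}$ be a non-negative vector. For $L\subseteq V$ and a graph $H$, $\delta_H(L)$ is the set of edges of $H$ with exactly one extreme in $L$, and $\delta(L)=\delta_G(L)$. An edge $e$ is tight if $\sum_{L:e\in\delta(L)}y_L=c_e$; a subset $L\subseteq V$ is tight if $\sum_{S\subseteq L}y_S=\pi^\lambda_L$. Growth-phase $\mathtt{GP}(\lambda,\tau)$: here $\tau$ is a tie-breaking list, i.e. a finite (possibly empty) sequence $\tau_1,\dots,\tau_{|\tau|}$ of edges of $G$ and subsets of $V$. The algorithm maintains a forest $F\subseteq G$, collections $\mathcal B\subseteq\mathcal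 L\subseteq2^V$ and the vector $y$. $\mathcal L^*$ denotes the collection of inclusion-wise maximal members of $\mathcal L$ (it always partitions $V$); an edge is external in $\mathcal L^*$ if its extremes lie in two distinct members of $\mathcal L^*$, called its endpoints; the members of $\mathcal A=\mathcal L^*\setminus\mathcal B$ are called active. Initially $F=(V,\emptyset)$, $\mathcal L=\{\{v\}:v\in V\}$, $\mathcal B=\emptyset$, $y=0$. In iteration $i=1,2,\dots$: (1) if $\mathcal A=\{V\}$, return $(T,\mathcal B)$ with $T=F$. (2) Let $\Delta_1=0$ if some external edge is tight, and otherwise let $\Delta_1$ be the minimum of $\big(c_e-\sum_{L:e\in\delta(L)}y_L\big)/|\{L\in\mathcal A:e\in\delta(L)\}|$ over edges $e\in\delta(S)$, $S\in\mathcal A$; let $\Delta_2=0$ if some active subset is tight, and otherwise $\Delta_2=\min_{L\in\mathcal A}\big(\pi^\lambda_L-\sum_{S\subseteq L}y_S\big)$; increase $y_L$ by $\min\{\Delta_1,\Delta_2\}$ for every $L\in\mathcal A$. (3) Let $\mathcal Y$ be the set of tight external edges and $\mathcal Z$ the collection of tight active subsets. If $i\le|\tau|$ and $\tau_i\in\mathcal Y\cup\mathcal Z$, let $\sigma=\tau_i$; else, if $\mathcal Y\ne\emptyset$, let $\sigma$ be the first edge of $\mathcal Y$; else let $\sigma$ be the first subset of $\mathcal Z$ ("first" refers to a fixed order on edges and a fixed order on subsets). (4) If $\sigma$ is an edge with endpoints $L_1,L_2$, add $\sigma$ to $F$ and $L_1\cup L_2$ to $\mathcal L$; if $\sigma$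 is a subset, add $\sigma$ to $\mathcal B$. We say $\sigma$ is processed in iteration $i$. The final $y$ and $\mathcal L$ are said to be computed by $\mathtt{GP}(\lambda,\tau)$. Pruning-phase $\mathtt{PP}(H,\mathcal B)$: while there is $B\in\mathcal B$ with $|\delta_H(B)|=1$, delete the vertices of $B$ from $H$; return $H$. Modified Goemans–Williamson algorithm $\mathtt{GW}(\lambda,\tau)$: let $(T,\mathcal B)$ be returned by $\mathtt{GP}(\lambda,\tau)$ and return $\mathtt{PP}(T,\mathcal B)$. For a non-empty tie-breaking list $\tau$, $\widetilde\tau$ is its prefix of size $|\tau|-1$. The list $\tau$ is respected by $\lambda$ if the sequence of edges and subsets processed in the first $|\tau|$ iterations of $\mathtt{GP}(\lambda,\tau)$ is exactly $\tau$. The pair $(\lambda,\tau)$ is a threshold-tuple if $\tau$ is respected by $\lambda$ and, with $\widehat T=\mathtt{GW}(\lambda,\tau)$ and $\widehat T'=\mathtt{GW}(\lambda,\widetilde\tau)$, either $|V(\widehat T)|\ge k>|V(\widehat T')|$ or $|V(\widehat T)|<k\le|V(\widehat T')|$. -}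

module Defs where

open import Algebra.Core using (Op₁; Op₂)
open import Algebra.Bundles using (CommutativeRing)
open import Algebra.Structures using (IsCommutativeRing)
open import Data.Bool.Base using (Bool; not; _∨_; _xor_; if_then_else_)
import Data.Bool.Properties as Bool
open import Data.Fin.Base using (Fin) renaming (_<_ to _<ᶠ_)
open import Data.Fin.Subset
  using (Subset; inside; outside; _∈_; _⊆_; _∩_; _∪_; _─_; ∣_∣; ⁅_⁆; ⊤; ⊥)
open import Data.Fin.Subset.Properties using (_∈?_; _⊆?_)
open import Data.List.Base
  using (List; []; _∷_; _++_; _∷ʳ_; map; filter; foldr; length; head; drop; take; allFin)
import Data.List.Membership.DecPropositional as DecMembership
import Data.List.Membership.Propositional as ListMembership
open import Data.List.Relation.Binary.BagAndSetEquality using (_∼[_]_; set)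
open import Data.List.Relation.Unary.All using (All; all?)
open import Data.Maybe.Base using (Maybe; just) renaming (map to mapᴹ)
open import Data.Nat.Base using (ℕ; zero; suc) renaming (_≤_ to _≤ℕ_; _<_ to _<ℕ_)
open import Data.Product.Base using (∃; ∃₂; _×_; _,_; proj₁; proj₂)
open import Data.Sum.Base using (_⊎_)
open import Data.Vec.Base using ([]; _∷_; lookup; tabulate)
import Data.Vec.Properties as Vec
open import Function.Bundles using (_⇔_)
open import Function.Definitions using (Injective)
open import Level using (Lift; _⊔_; 0ℓ) renaming (suc to lsuc)
import Relation.Binary.Construct.Add.Supremum.Equality as AddEquality
import Relation.Binary.Construct.Add.Supremum.NonStrict as AddOrder
open import Relation.Binary.Construct.Closure.Equivalence using (EqClosure)
open import Relation.Binary.Core using (Rel)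
open import Relation.Binary.Definitions using (DecidableEquality)
open import Relation.Binary.PropositionalEquality.Core using (_≡_; _≢_)
open import Relation.Binary.Structures using (IsDecTotalOrder; IsStrictTotalOrder)
open import Relation.Nullary.Construct.Add.Supremum using (_⁺; ⊤⁺; [_])
open import Relation.Nullary.Decidable.Core
  using (Dec; does; ¬?; _×-dec_; _→-dec_)
open import Relation.Nullary.Negation.Core using (¬_)
open import Relation.Unary using (Pred)

-- Linearly ordered fields, standing in for ℝ. As usual for a total
-- inverse, nothing is required of 0# ⁻¹ beyond congruence.

record OrderedField c ℓ₁ ℓ₂ : Set (lsuc (c ⊔ ℓ₁ ⊔ ℓ₂)) where
  infix  8 _⁻¹ -_
  infixl 7 _*_
  infixl 6 _+_
  infix  4 _≈_ _≤_
  field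
    Carrier           : Set c
    _≈_               : Rel Carrier ℓ₁
    _≤_               : Rel Carrier ℓ₂
    _+_ _*_           : Op₂ Carrier
    -_ _⁻¹            : Op₁ Carrier
    0# 1#             : Carrier
    isCommutativeRing : IsCommutativeRing _≈_ _+_ _*_ -_ 0# 1#
    isDecTotalOrder   : IsDecTotalOrder _≈_ _≤_
    0≉1               : ¬ (0# ≈ 1#)
    ⁻¹-cong           : ∀ {x y} → x ≈ y → x ⁻¹ ≈ y ⁻¹
    *-inverseʳ        : ∀ x → ¬ (x ≈ 0#) → x * x ⁻¹ ≈ 1#
    +-monoʳ-≤         : ∀ x {y z} → y ≤ z → x + y ≤ x + z
    *-nonNegative     : ∀ {x y} → 0# ≤ x → 0# ≤ y → 0# ≤ x * y

  commutativeRing : CommutativeRing c ℓ₁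
  commutativeRing = record { isCommutativeRing = isCommutativeRing }

  open AddEquality _≈_ public using (_≈⁺_)
  open AddOrder _≤_ public using (_≤⁺_)

  fromℕ : ℕ → Carrier
  fromℕ zero    = 0#
  fromℕ (suc n) = 1# + fromℕ n

  sum : List Carrier → Carrier
  sum = foldr _+_ 0#

  infixl 6 _+⁺_ _-⁺_

  _+⁺_ : Op₂ (Carrier ⁺)
  [ x ] +⁺ [ y ] = [ x + y ]
  [ _ ] +⁺ ⊤⁺    = ⊤⁺
  ⊤⁺    +⁺ _     = ⊤⁺

  _-⁺_ : Carrier ⁺ → Carrier → Carrier ⁺
  x -⁺ y = mapᴹ (λ z → z + - y) x

  sum⁺ : List (Carrier ⁺) → Carrier ⁺
  sum⁺ = foldr _+⁺_ [ 0# ]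

  IsMinimum : ∀ {ℓ} → Pred (Carrier ⁺) ℓ → Carrier ⁺ → Set (c ⊔ ℓ₂ ⊔ ℓ)
  IsMinimum P x = P x × (∀ z → P z → x ≤⁺ z)

subsets : ∀ n → List (Subset n)
subsets zero    = [] ∷ []
subsets (suc n) = map (outside ∷_) (subsets n) ++ map (inside ∷_) (subsets n)

infix 4 _≟ˢ_

_≟ˢ_ : ∀ {n} → DecidableEquality (Subset n)
_≟ˢ_ = Vec.≡-dec Bool._≟_

-- Collections of subsets are lists, of which only the membership
-- relation is ever used.

Collection : ℕ → Set
Collection n = List (Subset n)

open ListMembership public using () renaming (_∈_ to _∈ᶜ_; _∉_ to _∉ᶜ_)

infix 4 _∈ᶜ?_ _≐_

_∈ᶜ?_ : ∀ {n} (L : Subset n) (𝓒 : Collection n) → Dec (L ∈ᶜ 𝓒)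
_∈ᶜ?_ = DecMembership._∈?_ _≟ˢ_

_≐_ : ∀ {n} → Rel (Collection n) 0ℓ
𝓒 ≐ 𝓓 = 𝓒 ∼[ set ] 𝓓

Maximal : ∀ {n} → Collection n → Pred (Subset n) 0ℓ
Maximal 𝓒 L = L ∈ᶜ 𝓒 × All (λ M → L ⊆ M → L ≡ M) 𝓒

maximal? : ∀ {n} (𝓒 : Collection n) L → Dec (Maximal 𝓒 L)
maximal? 𝓒 L = (L ∈ᶜ? 𝓒) ×-dec all? (λ M → (L ⊆? M) →-dec (L ≟ˢ M)) 𝓒

-- A finite connected simple graph on the vertices Fin n with edges
-- Fin m. The undirected edge {u , v} is recorded once, as the pair
-- (u , v) with u < v; this orientation carries no further meaning.

record Graph (n m : ℕ) : Set where
  field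
    extremes  : Fin m → Fin n × Fin n
    ordered   : ∀ e → proj₁ (extremes e) <ᶠ proj₂ (extremes e)
    injective : Injective _≡_ _≡_ extremes
    connected : ∀ u v → EqClosure (λ x z → ∃ λ e → extremes e ≡ (x , z)) u v

  source target : Fin m → Fin n
  source e = proj₁ (extremes e)
  target e = proj₂ (extremes e)

  δ : Subset n → Subset m
  δ L = tabulate λ e → lookup L (source e) xor lookup L (target e)

  meeting : Subset n → Subset m
  meeting L = tabulate λ e → lookup L (source e) ∨ lookup L (target e)

record Subgraph (n m : ℕ) : Set where
  constructor mkSubgraph
  field
    V : Subset n
    E : Subset m

open Subgraph public

infix  4 _⊆ᴳ_
infixl 6 _+ᴳ_

_⊆ᴳ_ : ∀ {n m} → Rel (Subgraph n m) 0ℓ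
H ⊆ᴳ H′ = V H ⊆ V H′ × E H ⊆ E H′

_+ᴳ_ : ∀ {n m} → Subgraph n m → Fin m → Subgraph n m
H +ᴳ e = mkSubgraph (V H) (E H ∪ ⁅ e ⁆)

record Instance {c ℓ₁ ℓ₂} (𝕂 : OrderedField c ℓ₁ ℓ₂) (n m : ℕ) :
                Set (c ⊔ ℓ₁ ⊔ ℓ₂) where
  open OrderedField 𝕂
  field
    graph        : Graph n m
    root         : Fin n
    k            : ℕ
    k≤n          : k ≤ℕ n
    cost         : Fin m → Carrier
    cost-nonNeg  : ∀ e → 0# ≤ cost e
    penalty      : Fin n → Carrier ⁺
    penalty-nonNeg : ∀ v → [ 0# ] ≤⁺ penalty v
    penalty-root : penalty root ≡ ⊤⁺

  open Graph graph public

-- The choices that the algorithm leaves to an implementation: a fixed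
-- order on edges, a fixed order on subsets, and, for the pruning
-- phase, which of the sets B ∈ 𝓑 with |δ_H(B)| = 1 is removed next. The
-- last may be any function of the graph H and the set 𝓑.

record Conventions {n m : ℕ} (G : Graph n m) : Set₁ where
  open Graph G
  field
    _≺ᵉ_                : Rel (Fin m) 0ℓ
    ≺ᵉ-isStrictTotalOrder : IsStrictTotalOrder _≡_ _≺ᵉ_
    _≺ˢ_                : Rel (Subset n) 0ℓ
    ≺ˢ-isStrictTotalOrder : IsStrictTotalOrder _≡_ _≺ˢ_

  Prunable : Subgraph n m → Collection n → Pred (Subset n) 0ℓ
  Prunable H 𝓑 B = B ∈ᶜ 𝓑 × ∣ E H ∩ δ B ∣ ≡ 1

  field
    pick          : Subgraph n m → Collection n → Subset n
    pick-prunable : ∀ H 𝓑 → ∃ (Prunable H 𝓑) → Prunable H 𝓑 (pick H 𝓑)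
    pick-cong     : ∀ H {𝓑 𝓑′} → 𝓑 ≐ 𝓑′ → pick H 𝓑 ≡ pick H 𝓑′

IsFirst : ∀ {a ℓ} {A : Set a} → Rel A 0ℓ → Pred A ℓ → Pred A (a ⊔ ℓ)
IsFirst _≺_ P x = P x × (∀ z → P z → ¬ (z ≺ x))

data Item (n m : ℕ) : Set where
  edge   : Fin m → Item n m
  subset : Subset n → Item n m

module Algorithm
  {c ℓ₁ ℓ₂} (𝕂 : OrderedField c ℓ₁ ℓ₂) {n m : ℕ} (I : Instance 𝕂 n m)
  (C : Conventions (Instance.graph I)) (potential : OrderedField.Carrier 𝕂)
  where

  open OrderedField 𝕂
  open Instance I
  open Conventions C

  record State : Set c where
    constructor mkState
    field
      F : Subgraph n m
      𝓛 : Collection n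
      𝓑 : Collection n
      y : Subset n → Carrier

  open State public

  initial : State
  initial = mkState (mkSubgraph ⊤ ⊥) (map ⁅_⁆ (allFin n)) [] (λ _ → 0#)

  -- π^λ_L, with λ written potential.
  penaltyOf : Subset n → Carrier ⁺
  penaltyOf L =
    sum⁺ (map penalty (filter (_∈? L) (allFin n))) +⁺ [ potential * fromℕ ∣ L ∣ ]

  edgeLoad : State → Fin m → Carrier
  edgeLoad s e = sum (map (y s) (filter (λ L → e ∈? δ L) (subsets n)))

  subsetLoad : State → Subset n → Carrier
  subsetLoad s L = sum (map (y s) (filter (_⊆? L) (subsets n)))

  TightEdge : State → Pred (Fin m) ℓ₁
  TightEdge s e = edgeLoad s e ≈ cost e

  TightSubset : State → Pred (Subset n) (c ⊔ ℓ₁)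
  TightSubset s L = [ subsetLoad s L ] ≈⁺ penaltyOf L

  Active : State → Pred (Subset n) 0ℓ
  Active s L = Maximal (𝓛 s) L × L ∉ᶜ 𝓑 s

  active? : ∀ s L → Dec (Active s L)
  active? s L = maximal? (𝓛 s) L ×-dec ¬? (L ∈ᶜ? 𝓑 s)

  record Endpoints (s : State) (e : Fin m) (L₁ L₂ : Subset n) : Set where
    field
      maximal₁ : Maximal (𝓛 s) L₁
      maximal₂ : Maximal (𝓛 s) L₂
      distinct : L₁ ≢ L₂
      source∈  : source e ∈ L₁
      target∈  : target e ∈ L₂

  External : State → Pred (Fin m) 0ℓ
  External s e = ∃₂ (Endpoints s e)

  𝒴 : State → Pred (Fin m) ℓ₁
  𝒴 s e = External s e × TightEdge s e

  𝒵 : State → Pred (Subset n) (c ⊔ ℓ₁)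
  𝒵 s L = Active s L × TightSubset s L

  activeCount : State → Fin m → ℕ
  activeCount s e =
    length (filter (λ L → active? s L ×-dec (e ∈? δ L)) (subsets n))

  edgeSlack : State → Fin m → Carrier
  edgeSlack s e = (cost e + - edgeLoad s e) * fromℕ (activeCount s e) ⁻¹

  data IsΔ₁ (s : State) : Pred (Carrier ⁺) (c ⊔ ℓ₁ ⊔ ℓ₂) where
    tight : ∃ (𝒴 s) → IsΔ₁ s [ 0# ]
    slack : ∀ {Δ} → ¬ ∃ (𝒴 s) →
            IsMinimum (λ x → ∃₂ λ e S → Active s S × e ∈ δ S ×
                                        x ≈⁺ [ edgeSlack s e ]) Δ →
            IsΔ₁ s Δ

  data IsΔ₂ (s : State) : Pred (Carrier ⁺) (c ⊔ ℓ₁ ⊔ ℓ₂) where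
    tight : ∃ (𝒵 s) → IsΔ₂ s [ 0# ]
    slack : ∀ {Δ} → ¬ ∃ (𝒵 s) →
            IsMinimum (λ x → ∃ λ L → Active s L ×
                                     x ≈⁺ (penaltyOf L -⁺ subsetLoad s L)) Δ →
            IsΔ₂ s Δ

  IsIncrement : State → Pred Carrier (c ⊔ ℓ₁ ⊔ ℓ₂)
  IsIncrement s Δ = ∃₂ λ Δ₁ Δ₂ → IsΔ₁ s Δ₁ × IsΔ₂ s Δ₂ ×
    IsMinimum (λ x → x ≈⁺ Δ₁ ⊎ x ≈⁺ Δ₂) [ Δ ]

  grow : State → Carrier → State
  grow s Δ = record s
    { y = λ L → if does (active? s L) then y s L + Δ else y s L }

  Candidate : State → Pred (Item n m) (c ⊔ ℓ₁)
  Candidate s (edge e)   = Lift c (𝒴 s e)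
  Candidate s (subset L) = 𝒵 s L

  -- Selects s t σ: σ is processed in state s when t is the entry of the
  -- tie-breaking list for this iteration, if there is one.
  data Selects (s : State) (t : Maybe (Item n m)) : Pred (Item n m) (c ⊔ ℓ₁) where
    tie-break   : ∀ {σ} → t ≡ just σ → Candidate s σ → Selects s t σ
    firstEdge   : ∀ {e} → ¬ (∃ λ σ → t ≡ just σ × Candidate s σ) →
                  IsFirst _≺ᵉ_ (𝒴 s) e → Selects s t (edge e)
    firstSubset : ∀ {L} → ¬ (∃ λ σ → t ≡ just σ × Candidate s σ) →
                  ¬ ∃ (𝒴 s) → IsFirst _≺ˢ_ (𝒵 s) L → Selects s t (subset L)

  data Processes (s : State) : Item n m → State → Set c where
    edge   : ∀ {e L₁ L₂} → Endpoints s e L₁ L₂ →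
             Processes s (edge e)
               (record s { F = F s +ᴳ e ; 𝓛 = (L₁ ∪ L₂) ∷ 𝓛 s })
    subset : ∀ {L} → Processes s (subset L) (record s { 𝓑 = L ∷ 𝓑 s })

  Finished : State → Set
  Finished s = ∀ L → Active s L ⇔ L ≡ ⊤

  -- Run τ s ρ s′: from s, with τ the not yet consulted part of the
  -- tie-breaking list, the algorithm processes the sequence ρ and
  -- returns in state s′. Each iteration consults one entry of τ.
  data Run (τ : List (Item n m)) (s : State) :
           List (Item n m) → State → Set (c ⊔ ℓ₁ ⊔ ℓ₂) where
    return  : Finished s → Run τ s [] s
    iterate : ∀ {Δ σ s₁ ρ s₂} → ¬ Finished s →
              IsIncrement s Δ →
              Selects (grow s Δ) (head τ) σ →
              Processes (grow s Δ) σ s₁ →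
              Run (drop 1 τ) s₁ ρ s₂ →
              Run τ s (σ ∷ ρ) s₂

  -- GP τ ρ s: the growth phase with tie-breaking list τ processes the
  -- sequence ρ and computes the tree F s, together with 𝓑 s, y s, 𝓛 s.
  GP : List (Item n m) → List (Item n m) → State → Set (c ⊔ ℓ₁ ⊔ ℓ₂)
  GP τ ρ s = Run τ initial ρ s

  delete : Subset n → Subgraph n m → Subgraph n m
  delete B H = mkSubgraph (V H ─ B) (E H ─ meeting B)

  data PP (H : Subgraph n m) (𝓑 : Collection n) : Subgraph n m → Set where
    return : ¬ ∃ (Prunable H 𝓑) → PP H 𝓑 H
    prune  : ∀ {H′} → ∃ (Prunable H 𝓑) →
             PP (delete (pick H 𝓑) H) 𝓑 H′ → PP H 𝓑 H′

  GW : List (Item n m) → Subgraph n m → Set (c ⊔ ℓ₁ ⊔ ℓ₂)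
  GW τ T̂ = ∃₂ λ ρ s → GP τ ρ s × PP (F s) (𝓑 s) T̂

  Respected : List (Item n m) → Set (c ⊔ ℓ₁ ⊔ ℓ₂)
  Respected τ = ∃₂ λ ρ s → GP τ ρ s × take (length τ) ρ ≡ τ

  -- The tuple whose tie-breaking list is τ ∷ʳ σ, that is, has last
  -- element σ and prefix τ.
  record ThresholdTuple (τ : List (Item n m)) (σ : Item n m) :
                        Set (c ⊔ ℓ₁ ⊔ ℓ₂) where
    field
      respected : Respected (τ ∷ʳ σ)
      T̂ T̂′      : Subgraph n m
      gw        : GW (τ ∷ʳ σ) T̂
      gw′       : GW τ T̂′
      threshold : (k ≤ℕ ∣ V T̂ ∣ × ∣ V T̂′ ∣ <ℕ k) ⊎ (∣ V T̂ ∣ <ℕ k × k ≤ℕ ∣ V T̂′ ∣)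

{-# OPTIONS --safe #-}

-- The two runs agree until σ, which is tight in both, is processed in the first one only.
-- From there on, the second run is the first one without σ. As long as σ can still be
-- processed there, the increment of the second run is zero, and either both runs process
-- the same item, or the second run alone processes σ or an edge joining the same two
-- components as the edge σ. After such a solitary step, or after an edge merges the subset σ
-- into a larger set, the two runs make the same choices to the end. If σ itself was
-- processed late, then both runs processed the same items, so the pruning phase returns the
-- same tree in both cases, which the threshold condition excludes. That the common
-- increment is zero while something is tight rests on the dual feasibility of y.
module Submission where

open import Defs
open import Algebra.Bundles using (CommutativeMonoid; CommutativeRing)
import Algebra.Properties.CommutativeSemigroup as CommutativeSemigroupProperties
import Algebra.Properties.Ring as RingProperties
open import Data.Bool.Base using (true; false; if_then_else_; _xor_)
open import Data.Bool.Properties using (if-eta)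
import Data.Empty as Empty
open import Data.Fin.Base using (Fin)
import Data.Fin.Properties as Fin
open import Data.Fin.Subset
  using (Subset; inside; outside; _∈_; _∉_; _⊆_; _∪_; ∣_∣; ⁅_⁆; ⊤; Nonempty)
open import Data.Fin.Subset.Properties
open import Data.List.Base
  using (List; []; _∷_; _++_; _∷ʳ_; map; filter; foldr; length; drop; allFin)
open import Data.List.Membership.Propositional using () renaming (_∈_ to _∈ˡ_; _∉_ to _∉ˡ_)
open import Data.List.Membership.Propositional.Properties
  using (∈-filter⁺; ∈-filter⁻; ∈-map⁺; ∈-map⁻; ∈-++⁺ˡ; ∈-++⁺ʳ; ∈-allFin; ∈-length)
import Data.List.Properties as List
open import Data.List.Relation.Binary.Permutation.Propositional using (↭-sym)
open import Data.List.Relation.Binary.Permutation.Propositional.Properties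
  using (shift; ∈-resp-↭)
import Data.List.Relation.Unary.All as All
open import Data.List.Relation.Unary.AllPairs using ([]; _∷_)
open import Data.List.Relation.Unary.Any using (here; there)
open import Data.List.Relation.Unary.Unique.Propositional using (Unique)
import Data.List.Relation.Unary.Unique.Propositional.Properties as Unique
open import Data.Maybe.Base using (nothing)
open import Data.Nat.Base using (ℕ; zero; suc; s≤s; z≤n)
  renaming (_+_ to _+ℕ_; _≤_ to _≤ℕ_; _<_ to _<ℕ_)
import Data.Nat.Properties as ℕ
open import Data.Product.Base using (∃; _×_; _,_; proj₁; proj₂)
open import Data.Sum.Base as Sum using (_⊎_; inj₁; inj₂)
open import Data.Vec.Base using ([]; _∷_; lookup; here; there)
import Data.Vec.Properties as Vec
open import Function.Base using (_∘_; id)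
open import Function.Bundles using (_⇔_; mk⇔; Equivalence)
open import Level using (lift; lower; _⊔_)
import Relation.Binary.Construct.Add.Supremum.Equality as AddEquality
import Relation.Binary.Construct.Add.Supremum.NonStrict as AddOrder
open import Relation.Binary.Definitions using (tri<; tri≈; tri>)
open import Relation.Binary.PropositionalEquality
  using (_≡_; _≢_; refl; sym; trans; cong; cong₂; subst)
import Relation.Binary.Reasoning.Setoid as SetoidReasoning
open import Relation.Binary.Structures using (IsDecTotalOrder; IsStrictTotalOrder)
open import Relation.Nullary using (¬_; Dec; yes; no; does; contradiction; _×-dec_)
open import Relation.Nullary.Decidable using (dec-false; does-⇔)
open import Relation.Nullary.Construct.Add.Supremum using (_⁺; ⊤⁺; [_])
open import Relation.Unary as Unary using (Pred)

-- Merging the same parts in another order yields a different collection `𝓛`, so equality of states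
-- is too much to ask. What steers the growth phase is only the partition into maximal sets, which
-- of these are blocked, and `y`; the states are compared in these terms alone.
--
-- Delaying `σ` does no harm to `y` because a pending candidate forces zero increments: it is then
-- irrelevant that, for instance, a subset `σ` is active in one run and blocked in the other. Nor
-- can the second run return meanwhile: an external edge needs two parts, and a tight active `⊤`
-- would have to pay the infinite penalty of the root.
--
-- By then both tie-breaking lists are exhausted, so all choices follow the fixed orders. If `σ` is
-- an edge, the first run has the coarser partition, and its tight external edges are available in
-- the second run as well; hence an edge that is first in the second run and available in the first
-- one is first in both. Edges precede subsets, so the second run processes only edges while an edge
-- `σ` is pending, which is the source of `𝓑 = 𝓑′`.

-- Sums over filtered lists in a commutative monoid

module MonoidSums {a ℓ} (M : CommutativeMonoid a ℓ) where
  open CommutativeMonoid M renaming (refl to ≈-refl; sym to ≈-sym; trans to ≈-trans)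
  open SetoidReasoning setoid

  fold : List Carrier → Carrier
  fold = foldr _∙_ ε

  -- The disjunction says that, wherever f does not vanish, P is the
  -- disjoint union of Q and R.
  module _ {i p q r} {A : Set i} {P : Pred A p} {Q : Pred A q} {R : Pred A r}
           (P? : Unary.Decidable P) (Q? : Unary.Decidable Q) (R? : Unary.Decidable R)
           (f : A → Carrier)
           (split : ∀ x → f x ≈ ε ⊎ (P x × Q x × ¬ R x) ⊎ (P x × ¬ Q x × R x) ⊎
                          (¬ P x × ¬ Q x × ¬ R x)) where

    private
      skip : ∀ {s} {S : Pred A s} (S? : Unary.Decidable S) x xs → f x ≈ ε →
             fold (map f (filter S? (x ∷ xs))) ≈ fold (map f (filter S? xs))
      skip S? x xs fx≈ε with does (S? x)
      ... | true  = ≈-trans (∙-congʳ fx≈ε) (identityˡ _)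
      ... | false = ≈-refl

    -- An arbitrary commutative monoid is taken because additivity over unions is wanted twice: for
    -- loads, in the field, and for penalties, where values may be infinite. The alternative
    -- `f x ≈ ε` covers sets that straddle two parts: they satisfy `P` but neither `Q` nor `R`, and
    -- carry no `y`.
    fold-filter-split : ∀ xs → fold (map f (filter P? xs)) ≈
                               fold (map f (filter Q? xs)) ∙ fold (map f (filter R? xs))
    fold-filter-split []       = ≈-sym (identityˡ _)
    fold-filter-split (x ∷ xs) with split x
    ... | inj₁ fx≈ε = begin
      fold (map f (filter P? (x ∷ xs))) ≈⟨ skip P? x xs fx≈ε ⟩
      fold (map f (filter P? xs))       ≈⟨ fold-filter-split xs ⟩
      fold (map f (filter Q? xs)) ∙ fold (map f (filter R? xs))
        ≈⟨ ∙-cong (skip Q? x xs fx≈ε) (skip R? x xs fx≈ε) ⟨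
      fold (map f (filter Q? (x ∷ xs))) ∙ fold (map f (filter R? (x ∷ xs))) ∎
    ... | inj₂ (inj₁ (px , qx , ¬rx))
      rewrite List.filter-accept P? {xs = xs} px | List.filter-accept Q? {xs = xs} qx
            | List.filter-reject R? {xs = xs} ¬rx =
      ≈-trans (∙-congˡ (fold-filter-split xs)) (≈-sym (assoc _ _ _))
    ... | inj₂ (inj₂ (inj₁ (px , ¬qx , rx)))
      rewrite List.filter-accept P? {xs = xs} px | List.filter-reject Q? {xs = xs} ¬qx
            | List.filter-accept R? {xs = xs} rx = begin
      f x ∙ fold (map f (filter P? xs)) ≈⟨ ∙-congˡ (fold-filter-split xs) ⟩
      f x ∙ (fold (map f (filter Q? xs)) ∙ fold (map f (filter R? xs))) ≈⟨ assoc _ _ _ ⟨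
      (f x ∙ fold (map f (filter Q? xs))) ∙ fold (map f (filter R? xs)) ≈⟨ ∙-congʳ (comm _ _) ⟩
      (fold (map f (filter Q? xs)) ∙ f x) ∙ fold (map f (filter R? xs)) ≈⟨ assoc _ _ _ ⟩
      fold (map f (filter Q? xs)) ∙ (f x ∙ fold (map f (filter R? xs))) ∎
    ... | inj₂ (inj₂ (inj₂ (¬px , ¬qx , ¬rx)))
      rewrite List.filter-reject P? {xs = xs} ¬px | List.filter-reject Q? {xs = xs} ¬qx
            | List.filter-reject R? {xs = xs} ¬rx = fold-filter-split xs

-- Ordered fields and values with infinity

module OrderedFieldProperties {c ℓ₁ ℓ₂} (𝕂 : OrderedField c ℓ₁ ℓ₂) where
  open OrderedField 𝕂
  open CommutativeRing commutativeRing public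
    using ( +-cong; +-congˡ; +-congʳ; +-assoc; +-comm; +-identityˡ; +-identityʳ
          ; -‿inverseˡ; -‿inverseʳ; *-cong; *-congˡ; *-assoc; *-comm; *-identityˡ
          ; *-identityʳ; distribˡ; distribʳ; zeroˡ; zeroʳ; -‿cong; ring; setoid
          ; +-commutativeMonoid )
    renaming (refl to ≈-refl; sym to ≈-sym; trans to ≈-trans; reflexive to ≈-reflexive)
  open CommutativeSemigroupProperties
    (CommutativeMonoid.commutativeSemigroup +-commutativeMonoid) using (interchange)
  open IsDecTotalOrder isDecTotalOrder public
    using (antisym; total) renaming (refl to ≤-refl; trans to ≤-trans; reflexive to ≤-reflexive)
  open AddEquality _≈_ public using ([_]; ⊤⁺≈⊤⁺)
  open AddOrder _≤_ public using ([_]; _≤⊤⁺; [≤]-injective)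

  open MonoidSums +-commutativeMonoid public
    using () renaming (fold-filter-split to sum-filter-split)

  ≈⁺-refl : ∀ {x} → x ≈⁺ x
  ≈⁺-refl = AddEquality.≈⁺-refl _≈_ ≈-refl

  ≈⁺-sym : ∀ {x y} → x ≈⁺ y → y ≈⁺ x
  ≈⁺-sym = AddEquality.≈⁺-sym _≈_ ≈-sym

  ≈⁺-trans : ∀ {x y z} → x ≈⁺ y → y ≈⁺ z → x ≈⁺ z
  ≈⁺-trans = AddEquality.≈⁺-trans _≈_ ≈-trans

  ≤⁺-trans : ∀ {x y z} → x ≤⁺ y → y ≤⁺ z → x ≤⁺ z
  ≤⁺-trans = AddOrder.≤⁺-trans _≤_ ≤-trans

  ≤⁺-reflexive : ∀ {x y} → x ≈⁺ y → x ≤⁺ y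
  ≤⁺-reflexive = AddOrder.≤⁺-reflexive _≤_ ≤-reflexive

  ≤⁺-antisym : ∀ {x y} → x ≤⁺ y → y ≤⁺ x → x ≈⁺ y
  ≤⁺-antisym = AddOrder.≤⁺-antisym _≤_ antisym

  ≤-respˡ : ∀ {x y z} → x ≈ y → x ≤ z → y ≤ z
  ≤-respˡ x≈y = ≤-trans (≤-reflexive (≈-sym x≈y))

  ≤-respʳ : ∀ {x y z} → y ≈ z → x ≤ y → x ≤ z
  ≤-respʳ y≈z x≤y = ≤-trans x≤y (≤-reflexive y≈z)

  +-monoˡ-≤ : ∀ z {x y} → x ≤ y → x + z ≤ y + z
  +-monoˡ-≤ z x≤y = ≤-respˡ (+-comm z _) (≤-respʳ (+-comm z _) (+-monoʳ-≤ z x≤y))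

  +-mono-≤ : ∀ {x y u v} → x ≤ y → u ≤ v → x + u ≤ y + v
  +-mono-≤ {y = y} {u} x≤y u≤v = ≤-trans (+-monoˡ-≤ u x≤y) (+-monoʳ-≤ y u≤v)

  x+[y-x]≈y : ∀ x y → x + (y + - x) ≈ y
  x+[y-x]≈y x y = ≈-trans (+-comm _ _)
    (≈-trans (+-assoc _ _ _) (≈-trans (+-congˡ (-‿inverseˡ x)) (+-identityʳ y)))

  x≤y⇒0≤y-x : ∀ {x y} → x ≤ y → 0# ≤ y + - x
  x≤y⇒0≤y-x {x} x≤y = ≤-respˡ (-‿inverseʳ x) (+-monoˡ-≤ (- x) x≤y)

  y≤z-x⇒x+y≤z : ∀ {x y z} → y ≤ z + - x → x + y ≤ z
  y≤z-x⇒x+y≤z {x} {y} {z} y≤z-x = ≤-respʳ (x+[y-x]≈y x z) (+-monoʳ-≤ x y≤z-x)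

  *-monoʳ-≤ : ∀ {x y z} → 0# ≤ x → y ≤ z → x * y ≤ x * z
  *-monoʳ-≤ {x} {y} {z} 0≤x y≤z = ≤-respˡ (+-identityʳ _)
    (≤-respʳ (≈-trans (≈-sym (distribˡ x y (z + - y))) (*-congˡ (x+[y-x]≈y y z)))
      (+-monoʳ-≤ (x * y) (*-nonNegative 0≤x (x≤y⇒0≤y-x y≤z))))

  x≤0⇒0≤-x : ∀ {x} → x ≤ 0# → 0# ≤ - x
  x≤0⇒0≤-x x≤0 = ≤-respʳ (+-identityˡ _) (x≤y⇒0≤y-x x≤0)

  0≤1 : 0# ≤ 1#
  0≤1 with total 0# 1#
  ... | inj₁ 0≤1 = 0≤1
  ... | inj₂ 1≤0 = ≤-respʳ square (*-nonNegative (x≤0⇒0≤-x 1≤0) (x≤0⇒0≤-x 1≤0))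
    where
    open RingProperties ring using (-1*x≈-x)
    open import Algebra.Properties.Group (CommutativeRing.+-group commutativeRing)
      using (⁻¹-involutive)
    square : - 1# * - 1# ≈ 1#
    square = ≈-trans (-1*x≈-x (- 1#)) (⁻¹-involutive 1#)

  0≤fromℕ : ∀ n → 0# ≤ fromℕ n
  0≤fromℕ zero    = ≤-refl
  0≤fromℕ (suc n) = ≤-respˡ (+-identityˡ 0#) (+-mono-≤ 0≤1 (0≤fromℕ n))

  fromℕ-suc≉0 : ∀ n → ¬ (fromℕ (suc n) ≈ 0#)
  fromℕ-suc≉0 n 1+n≈0 = 0≉1 (antisym 0≤1
    (≤-respˡ (+-identityʳ 1#) (≤-respʳ 1+n≈0 (+-monoʳ-≤ 1# (0≤fromℕ n)))))

  fromℕ-+ : ∀ m n → fromℕ (m +ℕ n) ≈ fromℕ m + fromℕ n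
  fromℕ-+ zero    n = ≈-sym (+-identityˡ _)
  fromℕ-+ (suc m) n = ≈-trans (+-congˡ (fromℕ-+ m n)) (≈-sym (+-assoc _ _ _))

  ⁻¹-nonNegative : ∀ {x} → 0# ≤ x → ¬ (x ≈ 0#) → 0# ≤ x ⁻¹
  ⁻¹-nonNegative {x} 0≤x x≉0 with total 0# (x ⁻¹)
  ... | inj₁ 0≤x⁻¹ = 0≤x⁻¹
  ... | inj₂ x⁻¹≤0 = contradiction (antisym 0≤1 1≤0) 0≉1
    where
    1≤0 : 1# ≤ 0#
    1≤0 = ≤-respˡ (*-inverseʳ x x≉0) (≤-respʳ (zeroʳ x) (*-monoʳ-≤ 0≤x x⁻¹≤0))

  y≤z*x⁻¹⇒x*y≤z : ∀ {x y z} → 0# ≤ x → ¬ (x ≈ 0#) → y ≤ z * x ⁻¹ → x * y ≤ z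
  y≤z*x⁻¹⇒x*y≤z {x} {y} {z} 0≤x x≉0 y≤z/x = ≤-respʳ x*[z*x⁻¹]≈z (*-monoʳ-≤ 0≤x y≤z/x)
    where
    x*[z*x⁻¹]≈z : x * (z * x ⁻¹) ≈ z
    x*[z*x⁻¹]≈z = ≈-trans (*-comm _ _) (≈-trans (*-assoc _ _ _)
      (≈-trans (*-congˡ (≈-trans (*-comm _ _) (*-inverseʳ x x≉0))) (*-identityʳ z)))

  +⁺-commutativeMonoid : CommutativeMonoid c (c ⊔ ℓ₁)
  +⁺-commutativeMonoid = record
    { Carrier = Carrier ⁺
    ; _≈_     = _≈⁺_
    ; _∙_     = _+⁺_
    ; ε       = [ 0# ]
    ; isCommutativeMonoid = record
      { isMonoid = record
        { isSemigroup = record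
          { isMagma = record
            { isEquivalence = AddEquality.≈⁺-isEquivalence _≈_
                              (CommutativeRing.isEquivalence commutativeRing)
            ; ∙-cong        = +⁺-cong
            }
          ; assoc = +⁺-assoc
          }
        ; identity = (λ { [ x ] → [ +-identityˡ x ] ; ⊤⁺ → ⊤⁺≈⊤⁺ })
                   , (λ { [ x ] → [ +-identityʳ x ] ; ⊤⁺ → ⊤⁺≈⊤⁺ })
        }
      ; comm = λ { [ x ] [ y ] → [ +-comm x y ] ; [ _ ] ⊤⁺ → ⊤⁺≈⊤⁺
                 ; ⊤⁺ [ _ ] → ⊤⁺≈⊤⁺ ; ⊤⁺ ⊤⁺ → ⊤⁺≈⊤⁺ }
      }
    }
    where
    +⁺-cong : ∀ {x y u v} → x ≈⁺ y → u ≈⁺ v → x +⁺ u ≈⁺ y +⁺ v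
    +⁺-cong [ x≈y ] [ u≈v ] = [ +-cong x≈y u≈v ]
    +⁺-cong [ _ ]   ⊤⁺≈⊤⁺   = ⊤⁺≈⊤⁺
    +⁺-cong ⊤⁺≈⊤⁺   _       = ⊤⁺≈⊤⁺

    +⁺-assoc : ∀ x y z → (x +⁺ y) +⁺ z ≈⁺ x +⁺ (y +⁺ z)
    +⁺-assoc [ x ] [ y ] [ z ] = [ +-assoc x y z ]
    +⁺-assoc [ _ ] [ _ ] ⊤⁺    = ⊤⁺≈⊤⁺
    +⁺-assoc [ _ ] ⊤⁺    _     = ⊤⁺≈⊤⁺
    +⁺-assoc ⊤⁺    _     _     = ⊤⁺≈⊤⁺

  +⁺-mono-≤⁺ : ∀ {x y u v} → x ≤⁺ y → u ≤⁺ v → x +⁺ u ≤⁺ y +⁺ v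
  +⁺-mono-≤⁺ [ x≤y ]      [ u≤v ]     = [ +-mono-≤ x≤y u≤v ]
  +⁺-mono-≤⁺ {y = [ _ ]} _ (_ ≤⊤⁺)    = _ ≤⊤⁺
  +⁺-mono-≤⁺ {y = ⊤⁺}     _ _         = _ ≤⊤⁺

  sum⁺-nonNegative : ∀ {i} {A : Set i} (f : A → Carrier ⁺) → (∀ x → [ 0# ] ≤⁺ f x) →
                     ∀ xs → [ 0# ] ≤⁺ sum⁺ (map f xs)
  sum⁺-nonNegative f 0≤f []       = [ ≤-refl ]
  sum⁺-nonNegative f 0≤f (x ∷ xs) =
    ≤⁺-trans [ ≤-reflexive (≈-sym (+-identityˡ 0#)) ]
             (+⁺-mono-≤⁺ (0≤f x) (sum⁺-nonNegative f 0≤f xs))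

  sum⁺-⊤⁺ : ∀ {i} {A : Set i} (f : A → Carrier ⁺) {x} → f x ≡ ⊤⁺ →
            ∀ {xs} → x ∈ˡ xs → sum⁺ (map f xs) ≡ ⊤⁺
  sum⁺-⊤⁺ f fx≡⊤ (here refl) rewrite fx≡⊤ = refl
  sum⁺-⊤⁺ f fx≡⊤ {z ∷ _} (there x∈xs) rewrite sum⁺-⊤⁺ f fx≡⊤ x∈xs with f z
  ... | [ _ ] = refl
  ... | ⊤⁺    = refl

  sum-cong : ∀ {i} {A : Set i} {f g : A → Carrier} → (∀ x → f x ≈ g x) →
             ∀ xs → sum (map f xs) ≈ sum (map g xs)
  sum-cong f≈g []       = ≈-refl
  sum-cong f≈g (x ∷ xs) = +-cong (f≈g x) (sum-cong f≈g xs)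

  sum-zero : ∀ {i} {A : Set i} (xs : List A) → sum (map (λ _ → 0#) xs) ≈ 0#
  sum-zero []       = ≈-refl
  sum-zero (_ ∷ xs) = ≈-trans (+-identityˡ _) (sum-zero xs)

  module _ {i p q} {A : Set i} {P : Pred A p} {Q : Pred A q}
           (P? : Unary.Decidable P) (Q? : Unary.Decidable Q) (f : A → Carrier) (Δ : Carrier) where
    private
      P∩Q? = λ x → P? x ×-dec Q? x
      f+Δ = λ x → if does (P? x) then f x + Δ else f x

      f+Δ-accept : ∀ x → P x → f+Δ x ≈ f x + Δ
      f+Δ-accept x px with P? x
      ... | yes _  = ≈-refl
      ... | no ¬px = contradiction px ¬px

      f+Δ-reject : ∀ x → ¬ P x → f+Δ x ≈ f x
      f+Δ-reject x ¬px with P? x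
      ... | yes px = contradiction px ¬px
      ... | no _   = ≈-refl

    -- With activity for `P`, the function `f+Δ` is the `y` of `grow`. If `Q` selects the sets that
    -- an edge leaves, the length on the right is `activeCount`.
    sum-increase : ∀ xs → sum (map f+Δ (filter Q? xs)) ≈
                   sum (map f (filter Q? xs)) + fromℕ (length (filter P∩Q? xs)) * Δ
    sum-increase []       = ≈-sym (≈-trans (+-identityˡ _) (zeroˡ Δ))
    sum-increase (x ∷ xs) with P? x | Q? x
    ... | yes px | yes _ = begin
      f+Δ x + sum (map f+Δ (filter Q? xs))          ≈⟨ +-cong (f+Δ-accept x px) (sum-increase xs) ⟩
      (f x + Δ) + (s + fromℕ k * Δ)                 ≈⟨ interchange _ _ _ _ ⟩
      (f x + s) + (Δ + fromℕ k * Δ)                 ≈⟨ +-congˡ (+-congʳ (*-identityˡ Δ)) ⟨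
      (f x + s) + (1# * Δ + fromℕ k * Δ)            ≈⟨ +-congˡ (distribʳ Δ 1# (fromℕ k)) ⟨
      (f x + s) + (1# + fromℕ k) * Δ                ∎
      where
      open SetoidReasoning setoid
      s = sum (map f (filter Q? xs))
      k = length (filter P∩Q? xs)
    ... | yes _  | no _  = sum-increase xs
    ... | no ¬px | yes _ =
      ≈-trans (+-cong (f+Δ-reject x ¬px) (sum-increase xs)) (≈-sym (+-assoc _ _ _))
    ... | no _   | no _  = sum-increase xs

-- Finite subsets and cuts

∈-subsets : ∀ {n} (L : Subset n) → L ∈ˡ subsets n
∈-subsets []            = here refl
∈-subsets (outside ∷ L) = ∈-++⁺ˡ (∈-map⁺ _ (∈-subsets L))
∈-subsets (inside ∷ L)  = ∈-++⁺ʳ _ (∈-map⁺ _ (∈-subsets L))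

subsets-unique : ∀ n → Unique (subsets n)
subsets-unique zero    = All.[] ∷ []
subsets-unique (suc n) = Unique.++⁺
  (Unique.map⁺ Vec.∷-injectiveʳ (subsets-unique n))
  (Unique.map⁺ Vec.∷-injectiveʳ (subsets-unique n))
  λ { (v∈₁ , v∈₂) → different (proj₂ (proj₂ (∈-map⁻ _ v∈₁))) (proj₂ (proj₂ (∈-map⁻ _ v∈₂))) }
  where
  different : ∀ {v : Subset (suc n)} {p q : Subset n} → v ≡ outside ∷ p → ¬ (v ≡ inside ∷ q)
  different refl ()

length-unique≤1 : ∀ {a} {A : Set a} {x : A} {xs} → Unique xs →
                  (∀ {z} → z ∈ˡ xs → z ≡ x) → length xs ≤ℕ 1
length-unique≤1 []                     _    = z≤n
length-unique≤1 (_ ∷ [])               _    = s≤s z≤n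
length-unique≤1 ((y≢z All.∷ _) ∷ _ ∷ _) only =
  contradiction (trans (only (here refl)) (sym (only (there (here refl))))) y≢z

∣p∪q∣≡∣p∣+∣q∣ : ∀ {n} (p q : Subset n) → (∀ {x} → x ∈ p → x ∉ q) →
                ∣ p ∪ q ∣ ≡ ∣ p ∣ +ℕ ∣ q ∣
∣p∪q∣≡∣p∣+∣q∣ []            []            _   = refl
∣p∪q∣≡∣p∣+∣q∣ (inside ∷ p)  (inside ∷ q)  dis = contradiction here (dis here)
∣p∪q∣≡∣p∣+∣q∣ (inside ∷ p)  (outside ∷ q) dis =
  cong suc (∣p∪q∣≡∣p∣+∣q∣ p q (λ x∈p x∈q → dis (there x∈p) (there x∈q)))
∣p∪q∣≡∣p∣+∣q∣ (outside ∷ p) (inside ∷ q)  dis =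
  trans (cong suc (∣p∪q∣≡∣p∣+∣q∣ p q (λ x∈p x∈q → dis (there x∈p) (there x∈q))))
        (sym (ℕ.+-suc ∣ p ∣ ∣ q ∣))
∣p∪q∣≡∣p∣+∣q∣ (outside ∷ p) (outside ∷ q) dis =
  ∣p∪q∣≡∣p∣+∣q∣ p q (λ x∈p x∈q → dis (there x∈p) (there x∈q))

∪-lub : ∀ {n} {p q r : Subset n} → p ⊆ r → q ⊆ r → p ∪ q ⊆ r
∪-lub {p = p} {q} p⊆r q⊆r x∈p∪q = Sum.[ p⊆r , q⊆r ] (x∈p∪q⁻ p q x∈p∪q)

module _ {n m} (G : Graph n m) where
  open Graph G

  ∈δ⁻ : ∀ {e L} → e ∈ δ L →
        (source e ∈ L × target e ∉ L) ⊎ (source e ∉ L × target e ∈ L)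
  ∈δ⁻ {e} {L} e∈δ with source e ∈? L | target e ∈? L
  ... | yes a∈L | no b∉L  = inj₁ (a∈L , b∉L)
  ... | no a∉L  | yes b∈L = inj₂ (a∉L , b∈L)
  ... | yes a∈L | yes b∈L = contradiction (trans (sym (Vec.[]=⇒lookup e∈δ)) e≡outside) λ ()
    where
    e≡outside : lookup (δ L) e ≡ outside
    e≡outside = trans (Vec.lookup∘tabulate _ e)
      (cong₂ _xor_ (Vec.[]=⇒lookup a∈L) (Vec.[]=⇒lookup b∈L))
  ... | no a∉L  | no b∉L = contradiction (trans (sym (Vec.[]=⇒lookup e∈δ)) e≡outside) λ ()
    where
    e≡outside : lookup (δ L) e ≡ outside
    e≡outside = trans (Vec.lookup∘tabulate _ e) (cong₂ _xor_ (lookup-∉ a∉L) (lookup-∉ b∉L))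
      where
      lookup-∉ : ∀ {v} → v ∉ L → lookup L v ≡ outside
      lookup-∉ {v} v∉L with lookup L v in eq
      ... | inside  = contradiction (Vec.lookup⇒[]= v L eq) v∉L
      ... | outside = refl

  ∈δ⁺ : ∀ {e L} → (source e ∈ L × target e ∉ L) ⊎ (source e ∉ L × target e ∈ L) → e ∈ δ L
  ∈δ⁺ {e} {L} cut = Vec.lookup⇒[]= e (δ L) (trans (Vec.lookup∘tabulate _ e) (inside-xor cut))
    where
    inside-xor : (source e ∈ L × target e ∉ L) ⊎ (source e ∉ L × target e ∈ L) →
                 lookup L (source e) xor lookup L (target e) ≡ inside
    inside-xor (inj₁ (a∈L , b∉L)) rewrite Vec.[]=⇒lookup a∈L with lookup L (target e) in eq
    ... | inside  = contradiction (Vec.lookup⇒[]= _ L eq) b∉L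
    ... | outside = refl
    inside-xor (inj₂ (a∉L , b∈L)) rewrite Vec.[]=⇒lookup b∈L with lookup L (source e) in eq
    ... | inside  = contradiction (Vec.lookup⇒[]= _ L eq) a∉L
    ... | outside = refl

  -- Through this, the edges leaving a freshly merged set inherit feasibility from its two parts.
  ∈δ-∪⁻ : ∀ {e L M} → e ∈ δ (L ∪ M) → e ∈ δ L ⊎ e ∈ δ M
  ∈δ-∪⁻ {e} {L} {M} e∈δ∪ with ∈δ⁻ {e} {L ∪ M} e∈δ∪
  ... | inj₁ (a∈ , b∉) = Sum.map
    (λ a∈L → ∈δ⁺ (inj₁ (a∈L , b∉ ∘ x∈p∪q⁺ ∘ inj₁)))
    (λ a∈M → ∈δ⁺ (inj₁ (a∈M , b∉ ∘ x∈p∪q⁺ ∘ inj₂))) (x∈p∪q⁻ L M a∈)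
  ... | inj₂ (a∉ , b∈) = Sum.map
    (λ b∈L → ∈δ⁺ (inj₂ (a∉ ∘ x∈p∪q⁺ ∘ inj₁ , b∈L)))
    (λ b∈M → ∈δ⁺ (inj₂ (a∉ ∘ x∈p∪q⁺ ∘ inj₂ , b∈M))) (x∈p∪q⁻ L M b∈)

-- Laminar families and their maximal members

-- The properties of the family are recorded through its maximal members: they partition the ground
-- set, and each member lies below one of them, a unique one since members are nonempty.
record Laminar {n} (𝓛 : Collection n) : Set where
  field
    cover    : ∀ v → ∃ λ L → Maximal 𝓛 L × v ∈ L
    below    : ∀ {L} → L ∈ᶜ 𝓛 → ∃ λ M → Maximal 𝓛 M × L ⊆ M
    disjoint : ∀ {L M v} → Maximal 𝓛 L → Maximal 𝓛 M → v ∈ L → v ∈ M → L ≡ M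
    nonempty : ∀ {L} → L ∈ᶜ 𝓛 → Nonempty L

maximal-⊆ : ∀ {n} {𝓛 : Collection n} {L M} → Maximal 𝓛 L → M ∈ᶜ 𝓛 → L ⊆ M → L ≡ M
maximal-⊆ (_ , maximal) M∈𝓛 = All.lookup maximal M∈𝓛

laminar-singletons : ∀ n → Laminar (map ⁅_⁆ (allFin n))
laminar-singletons n = record
  { cover    = λ v → ⁅ v ⁆ , maximal (singleton v) , x∈⁅x⁆ v
  ; below    = λ L∈ → _ , maximal L∈ , id
  ; disjoint = λ { (L∈ , _) (M∈ , _) → same L∈ M∈ }
  ; nonempty = λ L∈ → let (v , _ , L≡) = ∈-map⁻ _ L∈ in v , subst (v ∈_) (sym L≡) (x∈⁅x⁆ v)
  }
  where
  𝓛₀ = map ⁅_⁆ (allFin n)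

  singleton : ∀ v → ⁅ v ⁆ ∈ᶜ 𝓛₀
  singleton v = ∈-map⁺ _ (∈-allFin v)

  same : ∀ {L M v} → L ∈ᶜ 𝓛₀ → M ∈ᶜ 𝓛₀ → v ∈ L → v ∈ M → L ≡ M
  same L∈ M∈ v∈L v∈M with ∈-map⁻ _ L∈ | ∈-map⁻ _ M∈
  ... | u , _ , refl | w , _ , refl =
    cong ⁅_⁆ (trans (sym (x∈⁅y⁆⇒x≡y u v∈L)) (x∈⁅y⁆⇒x≡y w v∈M))

  maximal : ∀ {L} → L ∈ᶜ 𝓛₀ → Maximal 𝓛₀ L
  maximal L∈ with ∈-map⁻ _ L∈
  ... | u , _ , refl = L∈ , All.tabulate λ M∈ L⊆M → same L∈ M∈ (x∈⁅x⁆ u) (L⊆M (x∈⁅x⁆ u))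

module Union {n} {𝓛 : Collection n} (lam : Laminar 𝓛) {L₁ L₂ : Subset n}
             (max₁ : Maximal 𝓛 L₁) (max₂ : Maximal 𝓛 L₂) (L₁≢L₂ : L₁ ≢ L₂) where
  open Laminar lam

  ⊈-member : ∀ {M} → M ∈ᶜ 𝓛 → ¬ (L₁ ∪ L₂ ⊆ M)
  ⊈-member M∈𝓛 ∪⊆M = L₁≢L₂ (trans
    (maximal-⊆ max₁ M∈𝓛 (∪⊆M ∘ p⊆p∪q L₂)) (sym (maximal-⊆ max₂ M∈𝓛 (∪⊆M ∘ q⊆p∪q L₁ L₂))))

  -- Blocked sets belong to the family, so this freshness shows that a set which has just been
  -- formed cannot be blocked already.
  ∪∉ : L₁ ∪ L₂ ∉ˡ 𝓛
  ∪∉ ∪∈𝓛 = ⊈-member ∪∈𝓛 id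

  maximal-∪ : Maximal (L₁ ∪ L₂ ∷ 𝓛) (L₁ ∪ L₂)
  maximal-∪ = here refl ,
    (λ _ → refl) All.∷ All.tabulate (λ M∈𝓛 ∪⊆M → contradiction (λ {x} → ∪⊆M {x}) (⊈-member M∈𝓛))

  disjoint-∪ : ∀ {L v} → Maximal 𝓛 L → L ≢ L₁ → L ≢ L₂ → v ∈ L → v ∉ L₁ ∪ L₂
  disjoint-∪ max L≢L₁ L≢L₂ v∈L v∈∪ with x∈p∪q⁻ L₁ L₂ v∈∪
  ... | inj₁ v∈L₁ = L≢L₁ (disjoint max max₁ v∈L v∈L₁)
  ... | inj₂ v∈L₂ = L≢L₂ (disjoint max max₂ v∈L v∈L₂)

  maximal⁺ : ∀ {L} → Maximal 𝓛 L → L ≢ L₁ → L ≢ L₂ → Maximal (L₁ ∪ L₂ ∷ 𝓛) L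
  maximal⁺ {L} max L≢L₁ L≢L₂ = there (proj₁ max) ,
    (λ L⊆∪ → contradiction (λ {x} → L⊆∪ {x}) L⊈∪) All.∷ proj₂ max
    where
    L⊈∪ : ¬ (L ⊆ L₁ ∪ L₂)
    L⊈∪ L⊆∪ = let (_ , v∈L) = nonempty (proj₁ max) in disjoint-∪ max L≢L₁ L≢L₂ v∈L (L⊆∪ v∈L)

  -- `L₁` and `L₂` drop out: each lies in the union, which differs from them by `∪∉`.
  maximal⁻ : ∀ {L} → Maximal (L₁ ∪ L₂ ∷ 𝓛) L → L ≡ L₁ ∪ L₂ ⊎ Maximal 𝓛 L × L ≢ L₁ × L ≢ L₂
  maximal⁻ (here L≡∪ , _) = inj₁ L≡∪
  maximal⁻ {L} (there L∈𝓛 , ⊆∪⇒≡ All.∷ max) = inj₂ ((L∈𝓛 , max) , L≢L₁ , L≢L₂)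
    where
    L≢∪ : L ≢ L₁ ∪ L₂
    L≢∪ refl = ∪∉ L∈𝓛
    L≢L₁ : L ≢ L₁
    L≢L₁ refl = L≢∪ (⊆∪⇒≡ (p⊆p∪q L₂))
    L≢L₂ : L ≢ L₂
    L≢L₂ refl = L≢∪ (⊆∪⇒≡ (q⊆p∪q L₁ L₂))

  ascend : ∀ {L} → Maximal 𝓛 L → ∃ λ M → Maximal (L₁ ∪ L₂ ∷ 𝓛) M × L ⊆ M
  ascend {L} max with L ≟ˢ L₁ | L ≟ˢ L₂
  ... | yes refl | _        = L₁ ∪ L₂ , maximal-∪ , p⊆p∪q L₂
  ... | no _     | yes refl = L₁ ∪ L₂ , maximal-∪ , q⊆p∪q L₁ L₂
  ... | no L≢L₁  | no L≢L₂  = L , maximal⁺ max L≢L₁ L≢L₂ , id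

  laminar : Laminar (L₁ ∪ L₂ ∷ 𝓛)
  laminar = record
    { cover    = cover′
    ; below    = below′
    ; disjoint = disjoint′
    ; nonempty = nonempty′
    }
    where
    cover′ : ∀ v → ∃ λ L → Maximal (L₁ ∪ L₂ ∷ 𝓛) L × v ∈ L
    cover′ v = let (L , max , v∈L) = cover v ; (M , max′ , L⊆M) = ascend max in M , max′ , L⊆M v∈L

    below′ : ∀ {L} → L ∈ᶜ L₁ ∪ L₂ ∷ 𝓛 → ∃ λ M → Maximal (L₁ ∪ L₂ ∷ 𝓛) M × L ⊆ M
    below′ (here refl) = _ , maximal-∪ , id
    below′ (there L∈𝓛) = let (M , max , L⊆M) = below L∈𝓛 ; (N , max′ , M⊆N) = ascend max in
      N , max′ , λ x∈L → M⊆N (L⊆M x∈L)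

    disjoint′ : ∀ {L M v} → Maximal (L₁ ∪ L₂ ∷ 𝓛) L → Maximal (L₁ ∪ L₂ ∷ 𝓛) M →
                v ∈ L → v ∈ M → L ≡ M
    disjoint′ maxL maxM v∈L v∈M with maximal⁻ maxL | maximal⁻ maxM
    ... | inj₁ refl | inj₁ refl = refl
    ... | inj₁ refl | inj₂ (max , ≢₁ , ≢₂) = contradiction v∈L (disjoint-∪ max ≢₁ ≢₂ v∈M)
    ... | inj₂ (max , ≢₁ , ≢₂) | inj₁ refl = contradiction v∈M (disjoint-∪ max ≢₁ ≢₂ v∈L)
    ... | inj₂ (maxL , _) | inj₂ (maxM , _) = disjoint maxL maxM v∈L v∈M

    nonempty′ : ∀ {L} → L ∈ᶜ L₁ ∪ L₂ ∷ 𝓛 → Nonempty L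
    nonempty′ (here refl) = let (v , v∈L₁) = nonempty (proj₁ max₁) in v , p⊆p∪q L₂ v∈L₁
    nonempty′ (there L∈𝓛) = nonempty L∈𝓛

-- Partitions described by closed sets

-- The maximal members of a laminar family are its minimal nonempty closed sets, and
-- processing an edge only adds the condition that its two extremes are not separated.
-- In terms of closed sets, the order in which edges are processed is thus irrelevant.

Closed : ∀ {n} → Collection n → Pred (Subset n) _
Closed 𝓛 X = ∀ L → L ∈ᶜ 𝓛 → ∀ {v} → v ∈ L → v ∈ X → L ⊆ X

infix 4 _≋_ _≋_+⟨_,_⟩

_≋_ : ∀ {n} → Collection n → Collection n → Set
𝓛 ≋ 𝓜 = ∀ X → Closed 𝓛 X ⇔ Closed 𝓜 X

_≋_+⟨_,_⟩ : ∀ {n} → Collection n → Collection n → Fin n → Fin n → Set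
𝓛 ≋ 𝓜 +⟨ a , b ⟩ = ∀ X → Closed 𝓛 X ⇔ (Closed 𝓜 X × (a ∈ X ⇔ b ∈ X))

to : ∀ {a b} {A : Set a} {B : Set b} → A ⇔ B → A → B
to = Equivalence.to

from : ∀ {a b} {A : Set a} {B : Set b} → A ⇔ B → B → A
from = Equivalence.from

≋-sym : ∀ {n} {𝓛 𝓜 : Collection n} → 𝓛 ≋ 𝓜 → 𝓜 ≋ 𝓛
≋-sym 𝓛≋𝓜 X = mk⇔ (from (𝓛≋𝓜 X)) (to (𝓛≋𝓜 X))

maximal-closed : ∀ {n} {𝓛 : Collection n} {L} → Laminar 𝓛 → Maximal 𝓛 L → Closed 𝓛 L
maximal-closed lam max M M∈𝓛 v∈M v∈L with N , maxN , M⊆N ← Laminar.below lam M∈𝓛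
  with refl ← Laminar.disjoint lam maxN max (M⊆N v∈M) v∈L = M⊆N

-- The two maximal members through a common vertex are closed in both families, so each contains the
-- other.
maximal-resp : ∀ {n} {𝓛 𝓜 : Collection n} → Laminar 𝓛 → Laminar 𝓜 → 𝓛 ≋ 𝓜 →
               ∀ {L} → Maximal 𝓛 L → Maximal 𝓜 L
maximal-resp {𝓜 = 𝓜} lam𝓛 lam𝓜 𝓛≋𝓜 {L} max
  with v , v∈L ← Laminar.nonempty lam𝓛 (proj₁ max)
  with M , maxM , v∈M ← Laminar.cover lam𝓜 v = subst (Maximal 𝓜) (⊆-antisym M⊆L L⊆M) maxM
  where
  M⊆L : M ⊆ L
  M⊆L = to (𝓛≋𝓜 L) (maximal-closed lam𝓛 max) _ (proj₁ maxM) v∈M v∈L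
  L⊆M : L ⊆ M
  L⊆M = from (𝓛≋𝓜 M) (maximal-closed lam𝓜 maxM) _ (proj₁ max) v∈L v∈M

-- The right side mentions the extremes `a` and `b` but not the merged sets, so the conditions
-- contributed by several edges commute.
closed-∪ : ∀ {n} {𝓛 : Collection n} {L M a b} → L ∈ᶜ 𝓛 → M ∈ᶜ 𝓛 → a ∈ L → b ∈ M →
           L ∪ M ∷ 𝓛 ≋ 𝓛 +⟨ a , b ⟩
closed-∪ {𝓛 = 𝓛} {L} {M} {a} {b} L∈𝓛 M∈𝓛 a∈L b∈M X = mk⇔
  (λ closed → (λ N N∈ → closed N (there N∈)) ,
    mk⇔ (λ a∈X → closed _ (here refl) (p⊆p∪q M a∈L) a∈X (q⊆p∪q L M b∈M))
        (λ b∈X → closed _ (here refl) (q⊆p∪q L M b∈M) b∈X (p⊆p∪q M a∈L)))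
  closed⁺
  where
  closed⁺ : Closed 𝓛 X × (a ∈ X ⇔ b ∈ X) → Closed (L ∪ M ∷ 𝓛) X
  closed⁺ (closed , a⇔b) N (there N∈) v∈N v∈X = closed N N∈ v∈N v∈X
  closed⁺ (closed , a⇔b) N (here refl) v∈∪ v∈X with x∈p∪q⁻ L M v∈∪
  ... | inj₁ v∈L = let L⊆X = closed L L∈𝓛 v∈L v∈X in
    ∪-lub L⊆X (closed M M∈𝓛 b∈M (to a⇔b (L⊆X a∈L)))
  ... | inj₂ v∈M = let M⊆X = closed M M∈𝓛 v∈M v∈X in
    ∪-lub (closed L L∈𝓛 a∈L (from a⇔b (M⊆X b∈M))) M⊆X

module _ {n} {𝓖 𝓗 : Collection n} {a b : Fin n} (lam : Laminar 𝓖) (𝓗≋𝓖+ab : 𝓗 ≋ 𝓖 +⟨ a , b ⟩)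
  {p q : Fin n} {M : Subset n} (M∈𝓗 : M ∈ᶜ 𝓗) (p∈M : p ∈ M) (q∈M : q ∈ M) where
  open Laminar lam

  private
    -- If `A` did not separate `a` from `b`, it would be closed in `𝓗`; but `M` crosses `A`.
    separates : ∀ {A u v} → Maximal 𝓖 A → u ∈ M → v ∈ M → u ∈ A → v ∉ A →
                (a ∈ A × b ∉ A) ⊎ (a ∉ A × b ∈ A)
    separates {A} maxA u∈M v∈M u∈A v∉A with a ∈? A | b ∈? A
    ... | yes a∈A | no b∉A  = inj₁ (a∈A , b∉A)
    ... | no a∉A  | yes b∈A = inj₂ (a∉A , b∈A)
    ... | yes a∈A | yes b∈A = contradiction
      (from (𝓗≋𝓖+ab A) (maximal-closed lam maxA , mk⇔ (λ _ → b∈A) (λ _ → a∈A)) M M∈𝓗 u∈M u∈A v∈M) v∉A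
    ... | no a∉A  | no b∉A  = contradiction
      (from (𝓗≋𝓖+ab A)
        (maximal-closed lam maxA , mk⇔ (λ a∈A → contradiction a∈A a∉A) (λ b∈A → contradiction b∈A b∉A))
        M M∈𝓗 u∈M u∈A v∈M) v∉A

  -- If adding the edge ab joins p to q, then adding the edge pq joins a to b.
  exchange : ∀ {A B} → Maximal 𝓖 A → Maximal 𝓖 B → A ≢ B → p ∈ A → q ∈ B →
             ∀ X → Closed 𝓖 X → (p ∈ X ⇔ q ∈ X) → (a ∈ X ⇔ b ∈ X)
  exchange {A} {B} maxA maxB A≢B p∈A q∈B X closed p⇔q
    with separates maxA p∈M q∈M p∈A (λ q∈A → A≢B (disjoint maxA maxB q∈A q∈B))
       | separates maxB q∈M p∈M q∈B (λ p∈B → A≢B (disjoint maxA maxB p∈A p∈B))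
  -- The edge `ab` leaves both `A` and `B`. These are disjoint, so one extreme lies in each, and a
  -- closed `X` contains all or nothing of `A` and of `B`.
  ... | inj₁ (a∈A , _) | inj₁ (a∈B , _) = contradiction (disjoint maxA maxB a∈A a∈B) A≢B
  ... | inj₂ (_ , b∈A) | inj₂ (_ , b∈B) = contradiction (disjoint maxA maxB b∈A b∈B) A≢B
  ... | inj₁ (a∈A , _) | inj₂ (_ , b∈B) = mk⇔
    (λ a∈X → closed _ (proj₁ maxB) q∈B (to p⇔q (closed _ (proj₁ maxA) a∈A a∈X p∈A)) b∈B)
    (λ b∈X → closed _ (proj₁ maxA) p∈A (from p⇔q (closed _ (proj₁ maxB) b∈B b∈X q∈B)) a∈A)
  ... | inj₂ (_ , b∈A) | inj₁ (a∈B , _) = mk⇔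
    (λ a∈X → closed _ (proj₁ maxA) p∈A (from p⇔q (closed _ (proj₁ maxB) a∈B a∈X q∈B)) b∈A)
    (λ b∈X → closed _ (proj₁ maxB) q∈B (to p⇔q (closed _ (proj₁ maxA) b∈A b∈X p∈A)) a∈B)

-- The predicates may differ, because two runs with different candidates are compared: it suffices
-- that each first element is also available on the other side.
isFirst-unique : ∀ {a ℓ ℓ′} {A : Set a} {_≺_ : A → A → Set} → IsStrictTotalOrder _≡_ _≺_ →
                 ∀ {P : Pred A ℓ} {Q : Pred A ℓ′} {x z} →
                 IsFirst _≺_ P x → IsFirst _≺_ Q z → P z → Q x → x ≡ z
isFirst-unique order {x = x} {z} (_ , x-first) (_ , z-first) Pz Qx
  with IsStrictTotalOrder.compare order x z
... | tri< x≺z _ _ = contradiction x≺z (z-first x Qx)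
... | tri≈ _ x≡z _ = x≡z
... | tri> _ _ z≺x = contradiction z≺x (x-first z Pz)

length≡suc⇒∈ : ∀ {a} {A : Set a} {xs : List A} {k} → length xs ≡ suc k → ∃ λ x → x ∈ˡ xs
length≡suc⇒∈ {xs = x ∷ _} _ = x , here refl

-- Growth phase: dual feasibility

module Growth {c ℓ₁ ℓ₂} (𝕂 : OrderedField c ℓ₁ ℓ₂) {n m : ℕ} (I : Instance 𝕂 n m)
  (C : Conventions (Instance.graph I)) (potential : OrderedField.Carrier 𝕂) where

  open OrderedField 𝕂
  open OrderedFieldProperties 𝕂
  open Instance I
  open Conventions C
  open Algorithm 𝕂 I C potential

  -- Feasibility is demanded where `y` can still grow: at maximal sets and at edges leaving them.
  -- `support` makes loads additive over maximal sets, and `𝓑⊆𝓛` keeps fresh unions unblocked.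
  record Sound (s : State) : Set (c ⊔ ℓ₁ ⊔ ℓ₂) where
    field
      laminar         : Laminar (𝓛 s)
      𝓑⊆𝓛             : ∀ {L} → L ∈ᶜ 𝓑 s → L ∈ᶜ 𝓛 s
      support         : ∀ {L} → L ∉ᶜ 𝓛 s → y s L ≈ 0#
      subset-feasible : ∀ {L} → Maximal (𝓛 s) L → [ subsetLoad s L ] ≤⁺ penaltyOf L
      edge-feasible   : ∀ {e L} → Maximal (𝓛 s) L → e ∈ δ L → edgeLoad s e ≤ cost e

    open Laminar laminar public

  open Sound

  external-resp : ∀ {s t} → (∀ {L} → Maximal (𝓛 s) L → Maximal (𝓛 t) L) →
                  ∀ {e} → External s e → External t e
  external-resp resp (L , M , ends) = L , M , record
    { maximal₁ = resp maximal₁ ; maximal₂ = resp maximal₂ ; distinct = distinct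
    ; source∈  = source∈ ; target∈ = target∈ }
    where open Endpoints ends

  selects⇒candidate : ∀ {s t σ} → Selects s t σ → Candidate s σ
  selects⇒candidate (tie-break _ candidate)          = candidate
  selects⇒candidate (firstEdge _ (e∈𝒴 , _))          = lift e∈𝒴
  selects⇒candidate (firstSubset _ _ (L∈𝒵 , _))      = L∈𝒵

  external-maximal : ∀ {s e L M} → Maximal (𝓛 s) L → Maximal (𝓛 s) M → L ≢ M →
                     source e ∈ L → target e ∈ M → External s e
  external-maximal maxL maxM L≢M a∈L b∈M = _ , _ , record
    { maximal₁ = maxL ; maximal₂ = maxM ; distinct = L≢M ; source∈ = a∈L ; target∈ = b∈M }

  external⇒∉member : ∀ {s} → Sound s → ∀ {e} → External s e →
                     ∀ {M} → M ∈ᶜ 𝓛 s → source e ∈ M → target e ∉ M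
  external⇒∉member snd (L₁ , L₂ , ends) M∈𝓛 a∈M b∈M =
    let (N , maxN , M⊆N) = below snd M∈𝓛
    in distinct (trans (disjoint snd maximal₁ maxN source∈ (M⊆N a∈M))
                       (disjoint snd maxN maximal₂ (M⊆N b∈M) target∈))
    where open Endpoints ends

  penaltyOf-∪ : ∀ {L M} → (∀ {v} → v ∈ L → v ∉ M) →
                penaltyOf L +⁺ penaltyOf M ≈⁺ penaltyOf (L ∪ M)
  penaltyOf-∪ {L} {M} dis = begin
    (S L +⁺ [ potential * fromℕ ∣ L ∣ ]) +⁺ (S M +⁺ [ potential * fromℕ ∣ M ∣ ])
      ≈⟨ interchange _ _ _ _ ⟩
    (S L +⁺ S M) +⁺ [ potential * fromℕ ∣ L ∣ + potential * fromℕ ∣ M ∣ ]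
      ≈⟨ ∙-cong (≈⁺-sym (fold-filter-split (_∈? L ∪ M) (_∈? L) (_∈? M) penalty split (allFin n)))
                [ sizes ] ⟩
    S (L ∪ M) +⁺ [ potential * fromℕ ∣ L ∪ M ∣ ] ∎
    where
    open CommutativeMonoid +⁺-commutativeMonoid using (∙-cong) renaming (setoid to setoid⁺)
    open CommutativeSemigroupProperties
      (CommutativeMonoid.commutativeSemigroup +⁺-commutativeMonoid) using (interchange)
    open MonoidSums +⁺-commutativeMonoid using (fold-filter-split)
    open SetoidReasoning setoid⁺

    S : Subset n → Carrier ⁺
    S X = sum⁺ (map penalty (filter (_∈? X) (allFin n)))

    sizes : potential * fromℕ ∣ L ∣ + potential * fromℕ ∣ M ∣ ≈ potential * fromℕ ∣ L ∪ M ∣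
    sizes = ≈-trans (≈-sym (distribˡ _ _ _)) (*-congˡ (≈-trans (≈-sym (fromℕ-+ ∣ L ∣ ∣ M ∣))
      (≈-reflexive (cong fromℕ (sym (∣p∪q∣≡∣p∣+∣q∣ L M dis))))))

    split : ∀ v → penalty v ≈⁺ [ 0# ] ⊎ (v ∈ L ∪ M × v ∈ L × v ∉ M) ⊎
                  (v ∈ L ∪ M × v ∉ L × v ∈ M) ⊎ (v ∉ L ∪ M × v ∉ L × v ∉ M)
    split v with v ∈? L | v ∈? M
    ... | yes v∈L | _       = inj₂ (inj₁ (p⊆p∪q M v∈L , v∈L , dis v∈L))
    ... | no v∉L  | yes v∈M = inj₂ (inj₂ (inj₁ (q⊆p∪q L M v∈M , v∉L , v∈M)))
    ... | no v∉L  | no v∉M  = inj₂ (inj₂ (inj₂ (Sum.[ v∉L , v∉M ] ∘ x∈p∪q⁻ L M , v∉L , v∉M)))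

  -- A set carrying `y` belongs to the family, hence lies inside a single maximal member; inside
  -- `L ∪ M` that member can only be `L` or `M`.
  subsetLoad-∪ : ∀ {s} → Sound s → ∀ {L M} → Maximal (𝓛 s) L → Maximal (𝓛 s) M → L ≢ M →
                 subsetLoad s (L ∪ M) ≈ subsetLoad s L + subsetLoad s M
  subsetLoad-∪ {s} snd {L} {M} maxL maxM L≢M =
    sum-filter-split (_⊆? L ∪ M) (_⊆? L) (_⊆? M) (y s) split (subsets n)
    where
    split : ∀ X → y s X ≈ 0# ⊎ (X ⊆ L ∪ M × X ⊆ L × ¬ X ⊆ M) ⊎
                  (X ⊆ L ∪ M × ¬ X ⊆ L × X ⊆ M) ⊎ (¬ X ⊆ L ∪ M × ¬ X ⊆ L × ¬ X ⊆ M)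
    split X with X ∈ᶜ? 𝓛 s
    ... | no X∉𝓛  = inj₁ (support snd X∉𝓛)
    ... | yes X∈𝓛 with v , v∈X ← nonempty snd X∈𝓛 | N , maxN , X⊆N ← below snd X∈𝓛
      with X ⊆? L | X ⊆? M
    ... | yes X⊆L | yes X⊆M = contradiction (disjoint snd maxL maxM (X⊆L v∈X) (X⊆M v∈X)) L≢M
    ... | yes X⊆L | no X⊈M  = inj₂ (inj₁ ((λ x∈X → p⊆p∪q M (X⊆L x∈X)) , X⊆L , X⊈M))
    ... | no X⊈L  | yes X⊆M = inj₂ (inj₂ (inj₁ ((λ x∈X → q⊆p∪q L M (X⊆M x∈X)) , X⊈L , X⊆M)))
    ... | no X⊈L  | no X⊈M  = inj₂ (inj₂ (inj₂ (X⊈∪ , X⊈L , X⊈M)))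
      where
      X⊈∪ : ¬ X ⊆ L ∪ M
      X⊈∪ X⊆∪ with x∈p∪q⁻ L M (X⊆∪ v∈X)
      ... | inj₁ v∈L with refl ← disjoint snd maxN maxL (X⊆N v∈X) v∈L = X⊈L X⊆N
      ... | inj₂ v∈M with refl ← disjoint snd maxN maxM (X⊆N v∈X) v∈M = X⊈M X⊆N

  0≤x-⁺y : ∀ {x y} → [ y ] ≤⁺ x → [ 0# ] ≤⁺ (x -⁺ y)
  0≤x-⁺y [ y≤x ]   = [ x≤y⇒0≤y-x y≤x ]
  0≤x-⁺y (_ ≤⊤⁺)   = _ ≤⊤⁺

  y≤z-⁺x⇒x+y≤z : ∀ {x y} z → [ y ] ≤⁺ (z -⁺ x) → [ x + y ] ≤⁺ z
  y≤z-⁺x⇒x+y≤z [ _ ] [ y≤z-x ] = [ y≤z-x⇒x+y≤z y≤z-x ]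
  y≤z-⁺x⇒x+y≤z ⊤⁺    _         = _ ≤⊤⁺

  active⇒maximal : ∀ {s L} → Active s L → Maximal (𝓛 s) L
  active⇒maximal = proj₁

  -- This guards the inverse in `edgeSlack`, about which nothing is known at zero.
  activeCount≢0 : ∀ {s e L} → Active s L → e ∈ δ L → activeCount s e ≢ 0
  activeCount≢0 {s} {e} {L} active e∈δL count≡0 = ℕ.n≮0 (subst (0 <ℕ_) count≡0
    (∈-length (∈-filter⁺ (λ M → active? s M ×-dec (e ∈? δ M)) (∈-subsets L) (active , e∈δL))))

  IsΔ₁-nonNegative : ∀ {s Δ₁} → Sound s → IsΔ₁ s Δ₁ → [ 0# ] ≤⁺ Δ₁
  IsΔ₁-nonNegative     snd (tight _) = [ ≤-refl ]
  IsΔ₁-nonNegative {s} snd (slack _ ((e , L , active , e∈δL , Δ₁≈) , _)) =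
    ≤⁺-trans [ 0≤slack ] (≤⁺-reflexive (≈⁺-sym Δ₁≈))
    where
    0≤slack : 0# ≤ edgeSlack s e
    0≤slack with activeCount s e in count≡
    ... | zero  = contradiction count≡ (activeCount≢0 {s} {e} active e∈δL)
    ... | suc k = *-nonNegative
      (x≤y⇒0≤y-x (edge-feasible snd (active⇒maximal {s} active) e∈δL))
      (⁻¹-nonNegative (0≤fromℕ (suc k)) (fromℕ-suc≉0 k))

  IsΔ₂-nonNegative : ∀ {s Δ₂} → Sound s → IsΔ₂ s Δ₂ → [ 0# ] ≤⁺ Δ₂
  IsΔ₂-nonNegative     snd (tight _) = [ ≤-refl ]
  IsΔ₂-nonNegative {s} snd (slack _ ((L , active , Δ₂≈) , _)) =
    ≤⁺-trans (0≤x-⁺y (subset-feasible snd (active⇒maximal {s} active)))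
             (≤⁺-reflexive (≈⁺-sym Δ₂≈))

  increment-nonNegative : ∀ {s Δ} → Sound s → IsIncrement s Δ → 0# ≤ Δ
  increment-nonNegative snd (_ , _ , isΔ₁ , isΔ₂ , Δ≈ , _) = [≤]-injective (Sum.[
    (λ Δ≈Δ₁ → ≤⁺-trans (IsΔ₁-nonNegative snd isΔ₁) (≤⁺-reflexive (≈⁺-sym Δ≈Δ₁))) ,
    (λ Δ≈Δ₂ → ≤⁺-trans (IsΔ₂-nonNegative snd isΔ₂) (≤⁺-reflexive (≈⁺-sym Δ≈Δ₂))) ] Δ≈)

  -- A tight edge makes `Δ₁` zero and a tight active set makes `Δ₂` zero, which bounds the minimum
  -- from above. Feasibility keeps the other term from being negative.
  candidate⇒increment≈0 : ∀ {s Δ} → Sound s → IsIncrement s Δ → ∃ (Candidate s) → Δ ≈ 0#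
  candidate⇒increment≈0 {s} {Δ} snd inc@(_ , _ , isΔ₁ , isΔ₂ , _ , Δ≤) (σ , candidate) =
    antisym (Δ≤0 σ candidate isΔ₁ isΔ₂ (Δ≤ _ (inj₁ ≈⁺-refl)) (Δ≤ _ (inj₂ ≈⁺-refl)))
            (increment-nonNegative snd inc)
    where
    Δ≤0 : ∀ σ → Candidate s σ → ∀ {Δ₁ Δ₂} → IsΔ₁ s Δ₁ → IsΔ₂ s Δ₂ →
          [ Δ ] ≤⁺ Δ₁ → [ Δ ] ≤⁺ Δ₂ → Δ ≤ 0#
    Δ≤0 (edge e)   (lift e∈𝒴) (tight _)     _             [ Δ≤0 ] _       = Δ≤0
    Δ≤0 (edge e)   (lift e∈𝒴) (slack ¬𝒴 _)  _             _       _       = contradiction (e , e∈𝒴) ¬𝒴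
    Δ≤0 (subset L) L∈𝒵        _             (tight _)     _       [ Δ≤0 ] = Δ≤0
    Δ≤0 (subset L) L∈𝒵        _             (slack ¬𝒵 _)  _       _       = contradiction (L , L∈𝒵) ¬𝒵

  y-grow-inactive : ∀ {s Δ L} → ¬ Active s L → y (grow s Δ) L ≡ y s L
  y-grow-inactive {s} {Δ} {L} inactive =
    cong (λ active → if active then y s L + Δ else y s L) (dec-false (active? s L) inactive)

  sound-grow : ∀ {s Δ} → Sound s → IsIncrement s Δ → Sound (grow s Δ)
  sound-grow {s} {Δ} snd inc@(Δ₁ , Δ₂ , isΔ₁ , isΔ₂ , _ , Δ≤) = record
    { laminar         = laminar snd
    ; 𝓑⊆𝓛             = 𝓑⊆𝓛 snd
    ; support         = λ L∉𝓛 → ≈-trans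
        (≈-reflexive (y-grow-inactive {s} (λ { ((L∈𝓛 , _) , _) → L∉𝓛 L∈𝓛 }))) (support snd L∉𝓛)
    ; subset-feasible = λ {L} max → ≤⁺-trans
        (≤⁺-reflexive [ sum-increase (active? s) (_⊆? L) (y s) Δ (subsets n) ])
        (subset-bound max (Unique.filter⁺ _ (subsets-unique n))
          (λ M∈ → proj₂ (∈-filter⁻ (λ M → active? s M ×-dec (M ⊆? L)) {xs = subsets n} M∈)))
    ; edge-feasible   = λ {e} max e∈δL → ≤-respˡ
        (≈-sym (sum-increase (active? s) (λ L → e ∈? δ L) (y s) Δ (subsets n)))
        (edge-bound isΔ₁ (Δ≤ _ (inj₁ ≈⁺-refl)) (edge-feasible snd max e∈δL) _ refl)
    }
    where
    increased : ∀ {L Δ₂} → Active s L → IsΔ₂ s Δ₂ → [ Δ ] ≤⁺ Δ₂ → [ subsetLoad s L + Δ ] ≤⁺ penaltyOf L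
    increased {L} active (tight _) [ Δ≤0 ] = ≤⁺-trans
      [ ≤-respʳ (+-identityʳ _) (+-monoʳ-≤ _ Δ≤0) ] (subset-feasible snd (active⇒maximal {s} active))
    increased {L} active (slack _ (_ , minimal)) Δ≤Δ₂ =
      y≤z-⁺x⇒x+y≤z (penaltyOf L) (≤⁺-trans Δ≤Δ₂ (minimal _ (L , active , ≈⁺-refl)))

    -- The only active set that can lie inside a maximal `L` is `L` itself. The list `Ms` therefore
    -- has at most one entry, and the load grows by `Δ` or not at all.
    subset-bound : ∀ {L} → Maximal (𝓛 s) L → ∀ {Ms} → Unique Ms →
                   (∀ {M} → M ∈ˡ Ms → Active s M × M ⊆ L) →
                   [ subsetLoad s L + fromℕ (length Ms) * Δ ] ≤⁺ penaltyOf L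
    subset-bound {L} max {[]} _ _ = ≤⁺-trans
      [ ≤-reflexive (≈-trans (+-congˡ (zeroˡ Δ)) (+-identityʳ _)) ] (subset-feasible snd max)
    subset-bound {L} max {M ∷ Ms} unique active with active (here refl)
    ... | act , M⊆L with refl ← maximal-⊆ (active⇒maximal {s} act) (proj₁ max) M⊆L = ≤⁺-trans
      [ +-monoʳ-≤ _ (≤-trans (≤-respʳ (*-comm _ _) (≤-respˡ (*-comm _ _)
          (*-monoʳ-≤ (increment-nonNegative snd inc) (fromℕ≤1 (length≤1)))))
          (≤-reflexive (*-identityˡ Δ))) ]
      (increased act isΔ₂ (Δ≤ _ (inj₂ ≈⁺-refl)))
      where
      length≤1 : length (M ∷ Ms) ≤ℕ 1
      length≤1 = length-unique≤1 unique λ N∈ →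
        maximal-⊆ (active⇒maximal {s} (proj₁ (active N∈))) (proj₁ max) (proj₂ (active N∈))
      fromℕ≤1 : ∀ {k} → k ≤ℕ 1 → fromℕ k ≤ 1#
      fromℕ≤1 z≤n       = 0≤1
      fromℕ≤1 (s≤s z≤n) = ≤-reflexive (+-identityʳ 1#)

    -- The count is generalised to `k` to split off zero, where the load stays the same. A positive
    -- count provides an active set that `e` leaves, which enters the slack of `e` into the minimum,
    -- and the inverse in that slack is then genuine.
    edge-bound : ∀ {e Δ₁} → IsΔ₁ s Δ₁ → [ Δ ] ≤⁺ Δ₁ → edgeLoad s e ≤ cost e →
                 ∀ k → activeCount s e ≡ k → edgeLoad s e + fromℕ k * Δ ≤ cost e
    edge-bound _ _ feasible zero _ = ≤-respˡ
      (≈-sym (≈-trans (+-congˡ (zeroˡ Δ)) (+-identityʳ _))) feasible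
    edge-bound (tight _) [ Δ≤0 ] feasible (suc k) _ = ≤-trans
      (≤-respʳ (+-identityʳ _) (+-monoʳ-≤ _ (≤-respʳ (zeroʳ _) (*-monoʳ-≤ (0≤fromℕ (suc k)) Δ≤0))))
      feasible
    edge-bound {e} (slack _ (_ , minimal)) Δ≤Δ₁ _ (suc k) count≡ =
      y≤z-x⇒x+y≤z (y≤z*x⁻¹⇒x*y≤z (0≤fromℕ (suc k)) (fromℕ-suc≉0 k)
        (subst (λ j → Δ ≤ (cost e + - edgeLoad s e) * fromℕ j ⁻¹) count≡ Δ≤slack))
      where
      Δ≤slack : Δ ≤ edgeSlack s e
      Δ≤slack with L , L∈ ← length≡suc⇒∈ count≡
        with _ , active , e∈δL ← ∈-filter⁻ (λ L → active? s L ×-dec (e ∈? δ L)) {xs = subsets n} L∈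
        = [≤]-injective (≤⁺-trans Δ≤Δ₁ (minimal _ (e , L , active , e∈δL , ≈⁺-refl)))

  sound-process : ∀ {s σ s′} → Sound s → Candidate s σ → Processes s σ s′ → Sound s′
  sound-process snd candidate subset = record
    { laminar         = laminar snd
    ; 𝓑⊆𝓛             = λ { (here refl) → proj₁ (proj₁ (proj₁ candidate)) ; (there L∈𝓑) → 𝓑⊆𝓛 snd L∈𝓑 }
    ; support         = support snd
    ; subset-feasible = subset-feasible snd
    ; edge-feasible   = edge-feasible snd
    }
  sound-process {s} snd _ (edge {L₁ = L₁} {L₂} ends) = record
    { laminar         = Union.laminar (laminar snd) maximal₁ maximal₂ distinct
    ; 𝓑⊆𝓛             = there ∘ 𝓑⊆𝓛 snd
    ; support         = λ L∉ → support snd (L∉ ∘ there)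
    ; subset-feasible = subset-feasible′ ∘ maximal⁻
    ; edge-feasible   = λ {e} max e∈δL → edge-feasible′ {e} (maximal⁻ max) e∈δL
    }
    where
    open Endpoints ends
    open Union (laminar snd) maximal₁ maximal₂ distinct using (maximal⁻)

    -- Load and penalty are both additive over two distinct maximal sets, so the feasibility of the
    -- parts adds up.
    subset-feasible′ : ∀ {L} → L ≡ L₁ ∪ L₂ ⊎ Maximal (𝓛 s) L × L ≢ L₁ × L ≢ L₂ →
                       [ subsetLoad s L ] ≤⁺ penaltyOf L
    subset-feasible′ (inj₂ (max , _)) = subset-feasible snd max
    subset-feasible′ (inj₁ refl)      = ≤⁺-trans
      (≤⁺-reflexive [ subsetLoad-∪ snd maximal₁ maximal₂ distinct ])
      (≤⁺-trans (+⁺-mono-≤⁺ (subset-feasible snd maximal₁) (subset-feasible snd maximal₂))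
        (≤⁺-reflexive (penaltyOf-∪ λ v∈L₁ v∈L₂ → distinct (disjoint snd maximal₁ maximal₂ v∈L₁ v∈L₂))))

    edge-feasible′ : ∀ {e L} → L ≡ L₁ ∪ L₂ ⊎ Maximal (𝓛 s) L × L ≢ L₁ × L ≢ L₂ → e ∈ δ L →
                     edgeLoad s e ≤ cost e
    edge-feasible′ (inj₂ (max , _)) e∈δL = edge-feasible snd max e∈δL
    edge-feasible′ (inj₁ refl)      e∈δ∪ =
      Sum.[ edge-feasible snd maximal₁ , edge-feasible snd maximal₂ ] (∈δ-∪⁻ graph {L = L₁} {L₂} e∈δ∪)

  sound-initial : 0# ≤ potential → Sound initial
  sound-initial 0≤potential = record
    { laminar         = laminar-singletons n
    ; 𝓑⊆𝓛             = λ ()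
    ; support         = λ _ → ≈-refl
    ; subset-feasible = λ {L} _ → ≤⁺-trans (≤⁺-reflexive [ sum-zero (filter (_⊆? L) (subsets n)) ])
                                           (0≤penaltyOf L)
    ; edge-feasible   = λ {e} _ _ → ≤-respˡ (≈-sym (sum-zero (filter (λ L → e ∈? δ L) (subsets n))))
                                            (cost-nonNeg e)
    }
    where
    0≤penaltyOf : ∀ L → [ 0# ] ≤⁺ penaltyOf L
    0≤penaltyOf L = ≤⁺-trans [ ≤-reflexive (≈-sym (+-identityˡ 0#)) ] (+⁺-mono-≤⁺
      (sum⁺-nonNegative penalty penalty-nonNeg (filter (_∈? L) (allFin n)))
      [ *-nonNegative 0≤potential (0≤fromℕ ∣ L ∣) ])

  penaltyOf-⊤ : penaltyOf ⊤ ≡ ⊤⁺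
  penaltyOf-⊤ rewrite sum⁺-⊤⁺ penalty penalty-root (∈-filter⁺ (_∈? ⊤) (∈-allFin root) ∈⊤) = refl

  -- In a finished state `⊤` is maximal, which leaves no room for two distinct endpoints, and it is
  -- the only active set; the root gives it an infinite penalty, which no load attains.
  candidate⇒¬finished : ∀ {s} → ∃ (Candidate s) → ¬ Finished s
  candidate⇒¬finished {s} (edge e , lift ((L₁ , L₂ , ends) , _)) finished =
    distinct (trans (maximal-⊆ maximal₁ ⊤∈𝓛 ⊆⊤) (sym (maximal-⊆ maximal₂ ⊤∈𝓛 ⊆⊤)))
    where
    open Endpoints ends
    ⊤∈𝓛 : ⊤ ∈ᶜ 𝓛 s
    ⊤∈𝓛 = proj₁ (proj₁ (from (finished ⊤) refl))
  candidate⇒¬finished (subset S , active , tightS) finished with refl ← to (finished S) active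
    rewrite penaltyOf-⊤ with tightS
  ... | ()

  -- Similar states make the same choices

  edgeLoad-cong : ∀ {s t} → (∀ L → y s L ≈ y t L) → ∀ e → edgeLoad s e ≈ edgeLoad t e
  edgeLoad-cong y≈ e = sum-cong y≈ (filter (λ L → e ∈? δ L) (subsets n))

  subsetLoad-cong : ∀ {s t} → (∀ L → y s L ≈ y t L) → ∀ L → subsetLoad s L ≈ subsetLoad t L
  subsetLoad-cong y≈ L = sum-cong y≈ (filter (_⊆? L) (subsets n))

  tightEdge-resp : ∀ {s t} → (∀ L → y s L ≈ y t L) → ∀ {e} → TightEdge s e → TightEdge t e
  tightEdge-resp {s} {t} y≈ {e} = ≈-trans (≈-sym (edgeLoad-cong {s} {t} y≈ e))

  tightSubset-resp : ∀ {s t} → (∀ L → y s L ≈ y t L) → ∀ {L} → TightSubset s L → TightSubset t L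
  tightSubset-resp {s} {t} y≈ {L} = ≈⁺-trans [ ≈-sym (subsetLoad-cong {s} {t} y≈ L) ]

  -- This is agreement in all that later choices depend on: activity consults `𝓑` at maximal sets
  -- only, and no choice reads `F`.
  record Similar (s t : State) : Set (c ⊔ ℓ₁ ⊔ ℓ₂) where
    field
      soundˡ : Sound s
      soundʳ : Sound t
      𝓛≋     : 𝓛 s ≋ 𝓛 t
      y≈     : ∀ L → y s L ≈ y t L
      𝓑⇔     : ∀ {L} → Maximal (𝓛 s) L → L ∈ᶜ 𝓑 s ⇔ L ∈ᶜ 𝓑 t

    maximal-to : ∀ {L} → Maximal (𝓛 s) L → Maximal (𝓛 t) L
    maximal-to = maximal-resp (laminar soundˡ) (laminar soundʳ) 𝓛≋

    maximal-from : ∀ {L} → Maximal (𝓛 t) L → Maximal (𝓛 s) L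
    maximal-from = maximal-resp (laminar soundʳ) (laminar soundˡ) (≋-sym {𝓛 = 𝓛 s} {𝓛 t} 𝓛≋)

    active-to : ∀ {L} → Active s L → Active t L
    active-to (max , L∉𝓑) = maximal-to max , L∉𝓑 ∘ from (𝓑⇔ max)

    active-from : ∀ {L} → Active t L → Active s L
    active-from (max , L∉𝓑) = maximal-from max , L∉𝓑 ∘ to (𝓑⇔ (maximal-from max))

    candidate-to : ∀ {σ} → Candidate s σ → Candidate t σ
    candidate-to {edge e}   (lift (external , tightE)) =
      lift (external-resp {s} {t} maximal-to external , tightEdge-resp {s} {t} y≈ tightE)
    candidate-to {subset L} (active , tightL) =
      active-to active , tightSubset-resp {s} {t} y≈ tightL

  open Similar

  similar-refl : ∀ {s} → Sound s → Similar s s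
  similar-refl snd = record
    { soundˡ = snd ; soundʳ = snd ; 𝓛≋ = λ _ → mk⇔ id id ; y≈ = λ _ → ≈-refl ; 𝓑⇔ = λ _ → mk⇔ id id }

  similar-sym : ∀ {s t} → Similar s t → Similar t s
  similar-sym {s} {t} sim = record
    { soundˡ = soundʳ sim
    ; soundʳ = soundˡ sim
    ; 𝓛≋     = ≋-sym {𝓛 = 𝓛 s} {𝓛 t} (𝓛≋ sim)
    ; y≈     = λ L → ≈-sym (y≈ sim L)
    ; 𝓑⇔     = λ max → let 𝓑⇔ = 𝓑⇔ sim (maximal-from sim max) in mk⇔ (from 𝓑⇔) (to 𝓑⇔)
    }

  candidate-from : ∀ {s t} → Similar s t → ∀ {σ} → Candidate t σ → Candidate s σ
  candidate-from sim {σ} = candidate-to (similar-sym sim) {σ}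

  finished-to : ∀ {s t} → Similar s t → Finished s → Finished t
  finished-to sim finished L =
    mk⇔ (λ active → to (finished L) (active-from sim active))
        (λ L≡⊤ → active-to sim (from (finished L) L≡⊤))

  edgeSlack-cong : ∀ {s t} → Similar s t → ∀ e → edgeSlack s e ≈ edgeSlack t e
  edgeSlack-cong {s} {t} sim e = *-cong
    (+-congˡ (-‿cong (edgeLoad-cong {s} {t} (y≈ sim) e)))
    (⁻¹-cong (≈-reflexive (cong (fromℕ ∘ length) (List.filter-≐
      (λ L → active? s L ×-dec (e ∈? δ L)) (λ L → active? t L ×-dec (e ∈? δ L))
      ((λ { (active , e∈δL) → active-to sim active , e∈δL })
      , λ { (active , e∈δL) → active-from sim active , e∈δL }) (subsets n)))))

  -- One inequality is enough here and for `Δ₂`: similarity is symmetric, and antisymmetry then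
  -- equates the increments.
  IsΔ₁-≤ : ∀ {s t Δ Δ′} → Similar s t → IsΔ₁ s Δ → IsΔ₁ t Δ′ → Δ ≤⁺ Δ′
  IsΔ₁-≤ sim (tight _)         (tight _)    = [ ≤-refl ]
  IsΔ₁-≤ sim (tight (e , e∈𝒴)) (slack ¬𝒴 _) =
    contradiction (e , lower (candidate-to sim {edge e} (lift e∈𝒴))) ¬𝒴
  IsΔ₁-≤ sim (slack ¬𝒴 _)      (tight (e , e∈𝒴)) =
    contradiction (e , lower (candidate-from sim {edge e} (lift e∈𝒴))) ¬𝒴
  IsΔ₁-≤ sim (slack _ (_ , minimal)) (slack _ ((e , L , active , e∈δL , Δ′≈) , _)) =
    minimal _ (e , L , active-from sim active , e∈δL ,
               ≈⁺-trans Δ′≈ [ ≈-sym (edgeSlack-cong sim e) ])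

  IsΔ₂-≤ : ∀ {s t Δ Δ′} → Similar s t → IsΔ₂ s Δ → IsΔ₂ t Δ′ → Δ ≤⁺ Δ′
  IsΔ₂-≤ sim (tight _)         (tight _)    = [ ≤-refl ]
  IsΔ₂-≤ sim (tight (L , L∈𝒵)) (slack ¬𝒵 _) =
    contradiction (L , candidate-to sim {subset L} L∈𝒵) ¬𝒵
  IsΔ₂-≤ sim (slack ¬𝒵 _)      (tight (L , L∈𝒵)) =
    contradiction (L , candidate-from sim {subset L} L∈𝒵) ¬𝒵
  IsΔ₂-≤ {s} {t} sim (slack _ (_ , minimal)) (slack _ ((L , active , Δ′≈) , _)) =
    minimal _ (L , active-from sim active , ≈⁺-trans Δ′≈ (-⁺-cong (penaltyOf L)))
    where
    -⁺-cong : ∀ x → x -⁺ subsetLoad t L ≈⁺ x -⁺ subsetLoad s L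
    -⁺-cong [ x ] = [ +-congˡ (-‿cong (subsetLoad-cong {t} {s} (λ M → ≈-sym (y≈ sim M)) L)) ]
    -⁺-cong ⊤⁺    = ⊤⁺≈⊤⁺

  increment-≤ : ∀ {s t Δ Δ′} → Similar s t → IsIncrement s Δ → IsIncrement t Δ′ → Δ ≤ Δ′
  increment-≤ sim (_ , _ , isΔ₁ , isΔ₂ , _ , Δ≤) (_ , _ , isΔ₁′ , isΔ₂′ , Δ′≈ , _) = [≤]-injective (Sum.[
    (λ Δ′≈Δ₁ → ≤⁺-trans (Δ≤ _ (inj₁ ≈⁺-refl))
      (≤⁺-trans (IsΔ₁-≤ sim isΔ₁ isΔ₁′) (≤⁺-reflexive (≈⁺-sym Δ′≈Δ₁)))) ,
    (λ Δ′≈Δ₂ → ≤⁺-trans (Δ≤ _ (inj₂ ≈⁺-refl))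
      (≤⁺-trans (IsΔ₂-≤ sim isΔ₂ isΔ₂′) (≤⁺-reflexive (≈⁺-sym Δ′≈Δ₂)))) ] Δ′≈)

  if-cong : ∀ b {x x′ z z′} → x ≈ x′ → z ≈ z′ → (if b then x else z) ≈ (if b then x′ else z′)
  if-cong true  x≈x′ _    = x≈x′
  if-cong false _    z≈z′ = z≈z′

  similar-grow : ∀ {s t Δ Δ′} → Similar s t → IsIncrement s Δ → IsIncrement t Δ′ →
                 Similar (grow s Δ) (grow t Δ′)
  similar-grow {s} {t} {Δ} {Δ′} sim inc inc′ = record
    { soundˡ = sound-grow (soundˡ sim) inc
    ; soundʳ = sound-grow (soundʳ sim) inc′
    ; 𝓛≋     = 𝓛≋ sim
    ; y≈     = grown
    ; 𝓑⇔     = 𝓑⇔ sim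
    }
    where
    Δ≈Δ′ : Δ ≈ Δ′
    Δ≈Δ′ = antisym (increment-≤ sim inc inc′) (increment-≤ (similar-sym sim) inc′ inc)

    grown : ∀ L → y (grow s Δ) L ≈ y (grow t Δ′) L
    grown L = subst (λ b → y (grow s Δ) L ≈ (if b then y t L + Δ′ else y t L))
      (does-⇔ (mk⇔ (active-to sim) (active-from sim)) (active? s L) (active? t L))
      (if-cong (does (active? s L)) (+-cong (y≈ sim L) Δ≈Δ′) (y≈ sim L))

  y-grow≈0 : ∀ {s Δ} → Δ ≈ 0# → ∀ L → y (grow s Δ) L ≈ y s L
  y-grow≈0 {s} {Δ} Δ≈0 L = ≈-trans
    (if-cong (does (active? s L)) (≈-trans (+-congˡ Δ≈0) (+-identityʳ _)) ≈-refl)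
    (≈-reflexive (if-eta (does (active? s L))))

  selects-unique : ∀ {s t τ σ σ′} → Similar s t → Selects s τ σ → Selects t τ σ′ → σ ≡ σ′
  selects-unique sim (tie-break refl _) (tie-break refl _) = refl
  selects-unique sim (tie-break {σ} τ≡ candidate) (firstEdge ¬tie _) =
    contradiction (_ , τ≡ , candidate-to sim {σ} candidate) ¬tie
  selects-unique sim (tie-break {σ} τ≡ candidate) (firstSubset ¬tie _ _) =
    contradiction (_ , τ≡ , candidate-to sim {σ} candidate) ¬tie
  selects-unique sim (firstEdge ¬tie _) (tie-break {σ} τ≡ candidate) =
    contradiction (_ , τ≡ , candidate-from sim {σ} candidate) ¬tie
  selects-unique sim (firstSubset ¬tie _ _) (tie-break {σ} τ≡ candidate) =
    contradiction (_ , τ≡ , candidate-from sim {σ} candidate) ¬tie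
  selects-unique sim (firstEdge _ first) (firstEdge _ first′) =
    cong edge (isFirst-unique ≺ᵉ-isStrictTotalOrder first first′
      (lower (candidate-from sim (lift (proj₁ first′)))) (lower (candidate-to sim (lift (proj₁ first)))))
  selects-unique sim (firstSubset _ _ first) (firstSubset _ _ first′) =
    cong subset (isFirst-unique ≺ˢ-isStrictTotalOrder first first′
      (candidate-from sim {subset _} (proj₁ first′)) (candidate-to sim {subset _} (proj₁ first)))
  selects-unique sim (firstEdge _ (e∈𝒴 , _)) (firstSubset _ ¬𝒴 _) =
    contradiction (_ , lower (candidate-to sim (lift e∈𝒴))) ¬𝒴
  selects-unique sim (firstSubset _ ¬𝒴 _) (firstEdge _ (e∈𝒴 , _)) =
    contradiction (_ , lower (candidate-from sim (lift e∈𝒴))) ¬𝒴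

  endpoints-unique : ∀ {s t e L₁ L₂ M₁ M₂} → Similar s t → Endpoints s e L₁ L₂ → Endpoints t e M₁ M₂ →
                     L₁ ≡ M₁ × L₂ ≡ M₂
  endpoints-unique sim ends ends′ =
    disjoint (soundʳ sim) (maximal-to sim maximal₁) N.maximal₁ source∈ N.source∈ ,
    disjoint (soundʳ sim) (maximal-to sim maximal₂) N.maximal₂ target∈ N.target∈
    where
    open Endpoints ends
    module N = Endpoints ends′

  process-closed : ∀ {s e s′} → Processes s (edge e) s′ → 𝓛 s′ ≋ 𝓛 s +⟨ source e , target e ⟩
  process-closed (edge ends) = closed-∪ (proj₁ maximal₁) (proj₁ maximal₂) source∈ target∈
    where open Endpoints ends

  similar-process : ∀ {s t σ s′ t′} → Similar s t → Candidate s σ →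
                    Processes s σ s′ → Processes t σ t′ → Similar s′ t′
  similar-process {s} {t} {σ} sim candidate subset subset = record
    { soundˡ = sound-process (soundˡ sim) candidate subset
    ; soundʳ = sound-process (soundʳ sim) (candidate-to sim {σ} candidate) subset
    ; 𝓛≋     = 𝓛≋ sim
    ; y≈     = y≈ sim
    ; 𝓑⇔     = λ max → mk⇔
        (λ { (here refl) → here refl ; (there L∈𝓑) → there (to (𝓑⇔ sim max) L∈𝓑) })
        (λ { (here refl) → here refl ; (there L∈𝓑) → there (from (𝓑⇔ sim max) L∈𝓑) })
    }
  similar-process {s} {t} {edge e} {s′} {t′} sim candidate p@(edge {L₁ = L₁} {L₂} ends) p′@(edge ends′)
    with refl , refl ← endpoints-unique sim ends ends′ = record
    { soundˡ = sound-process (soundˡ sim) candidate p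
    ; soundʳ = sound-process (soundʳ sim) (candidate-to sim {edge e} candidate) p′
    ; 𝓛≋     = λ X → mk⇔
        (λ closed → let (closed-s , a⇔b) = to (process-closed p X) closed in
          from (process-closed p′ X) (to (𝓛≋ sim X) closed-s , a⇔b))
        (λ closed → let (closed-t , a⇔b) = to (process-closed p′ X) closed in
          from (process-closed p X) (from (𝓛≋ sim X) closed-t , a⇔b))
    ; y≈     = y≈ sim
    ; 𝓑⇔     = 𝓑⇔′ ∘ maximal⁻
    }
    where
    open Endpoints ends
    open Union (laminar (soundˡ sim)) maximal₁ maximal₂ distinct using (maximal⁻; ∪∉)
    module N = Endpoints ends′
    module T = Union (laminar (soundʳ sim)) N.maximal₁ N.maximal₂ N.distinct

    𝓑⇔′ : ∀ {L} → L ≡ L₁ ∪ L₂ ⊎ Maximal (𝓛 s) L × L ≢ L₁ × L ≢ L₂ → L ∈ᶜ 𝓑 s ⇔ L ∈ᶜ 𝓑 t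
    -- The union is fresh in both families, hence blocked in neither state.
    𝓑⇔′ (inj₁ refl)      = mk⇔ (λ ∪∈𝓑 → contradiction (𝓑⊆𝓛 (soundˡ sim) ∪∈𝓑) ∪∉)
                               (λ ∪∈𝓑 → contradiction (𝓑⊆𝓛 (soundʳ sim) ∪∈𝓑) T.∪∉)
    𝓑⇔′ (inj₂ (max , _)) = 𝓑⇔ sim max

  -- For equal states this is determinism of the growth phase. For different ones it finishes the
  -- comparison once the lag has ended.
  similar-runs : ∀ {τ s t ρ ρ′ s′ t′} → Similar s t → Run τ s ρ s′ → Run τ t ρ′ t′ →
                 ρ ≡ ρ′ × (∀ L → y s′ L ≈ y t′ L)
  similar-runs sim (return _) (return _) = refl , y≈ sim
  similar-runs sim (return finished) (iterate ¬finished _ _ _ _) =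
    contradiction (finished-to sim finished) ¬finished
  similar-runs sim (iterate ¬finished _ _ _ _) (return finished) =
    contradiction (finished-to (similar-sym sim) finished) ¬finished
  similar-runs sim (iterate _ inc select process run) (iterate _ inc′ select′ process′ run′)
    with grown ← similar-grow sim inc inc′
    with refl ← selects-unique grown select select′
    with refl , y≈′ ← similar-runs
      (similar-process grown (selects⇒candidate select) process process′) run run′
    = refl , y≈′

  -- Items that can no longer be processed

  -- Once true, this persists and keeps the item from being processed.
  Dead : State → Item n m → Set
  Dead s (edge e)   = ∃ λ L → L ∈ᶜ 𝓛 s × source e ∈ L × target e ∈ L
  Dead s (subset S) = S ∈ᶜ 𝓛 s × ¬ Active s S

  dead-grow : ∀ {s Δ} σ → Dead s σ → Dead (grow s Δ) σ
  dead-grow (edge _)   dead = dead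
  dead-grow (subset _) dead = dead

  -- The condition `S ∈ᶜ 𝓛 s` makes inactivity permanent: a set outside the family could still arise
  -- as a union and become active.
  dead-process : ∀ {s σ s′} → Sound s → Processes s σ s′ → ∀ z → Dead s z → Dead s′ z
  dead-process snd subset (edge e)   dead             = dead
  dead-process snd subset (subset S) (S∈𝓛 , inactive) =
    S∈𝓛 , λ { (max , S∉𝓑) → inactive (max , S∉𝓑 ∘ there) }
  dead-process snd (edge _)    (edge e)   (L , L∈𝓛 , ab∈L) = L , there L∈𝓛 , ab∈L
  dead-process snd (edge ends) (subset S) (S∈𝓛 , inactive) = there S∈𝓛 , inactive′
    where
    open Endpoints ends
    open Union (laminar snd) maximal₁ maximal₂ distinct using (maximal⁻; ∪∉)
    inactive′ : ¬ _
    inactive′ (max , S∉𝓑) with maximal⁻ max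
    ... | inj₁ refl       = ∪∉ S∈𝓛
    ... | inj₂ (max′ , _) = inactive (max′ , S∉𝓑)

  processed⇒dead : ∀ {s σ s′} → Candidate s σ → Processes s σ s′ → Dead s′ σ
  processed⇒dead (active , _) subset =
    proj₁ (proj₁ active) , λ { (_ , S∉𝓑) → S∉𝓑 (here refl) }
  processed⇒dead _ (edge {L₁ = L₁} {L₂} ends) =
    L₁ ∪ L₂ , here refl , p⊆p∪q L₂ source∈ , q⊆p∪q L₁ L₂ target∈
    where open Endpoints ends

  dead⇒¬candidate : ∀ {s} → Sound s → ∀ σ → Dead s σ → ¬ Candidate s σ
  dead⇒¬candidate snd (edge e)   (L , L∈𝓛 , a∈L , b∈L) (lift (external , _)) =
    external⇒∉member snd external L∈𝓛 a∈L b∈L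
  dead⇒¬candidate snd (subset S) (_ , inactive) (active , _) = inactive active

  dead⇒∉ : ∀ {τ s ρ s′} → Sound s → Run τ s ρ s′ → ∀ {σ} → Dead s σ → σ ∉ˡ ρ
  dead⇒∉ snd (iterate _ inc select process run) {σ} dead = λ
    { (here refl)  → dead⇒¬candidate grown σ (dead-grow σ dead) (selects⇒candidate select)
    ; (there σ∈ρ) → dead⇒∉ (sound-process grown (selects⇒candidate select) process) run
        (dead-process grown process σ (dead-grow σ dead)) σ∈ρ }
    where grown = sound-grow snd inc

  -- A run lagging behind by one item

  -- While an edge is lagging, the maximal sets of the two states differ, so `𝓑` is compared on all
  -- sets, unlike in `Similar`.
  Ahead : Item n m → State → State → Set
  Ahead (edge e)   s g = 𝓛 s ≋ 𝓛 g +⟨ source e , target e ⟩ × (∀ {L} → L ∈ᶜ 𝓑 s ⇔ L ∈ᶜ 𝓑 g)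
  Ahead (subset S) s g = 𝓛 s ≋ 𝓛 g × (∀ {L} → L ∈ᶜ 𝓑 s ⇔ L ∈ᶜ S ∷ 𝓑 g)

  -- Up to the order of processing, s is the state g with σ processed in addition.
  record Lag (σ : Item n m) (s g : State) : Set (c ⊔ ℓ₁ ⊔ ℓ₂) where
    field
      sound-s   : Sound s
      sound-g   : Sound g
      y-agree   : ∀ L → y s L ≈ y g L
      candidate : Candidate g σ
      ahead     : Ahead σ s g

  -- On this side `σ` has been processed and no longer forces a zero increment, so `Δ ≈ 0#` is
  -- assumed. It is supplied by another candidate, shared by both states.
  lag-growˡ : ∀ {σ s g Δ} → Lag σ s g → IsIncrement s Δ → Δ ≈ 0# → Lag σ (grow s Δ) g
  lag-growˡ {σ} {s} {g} {Δ} lag inc Δ≈0 = record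
    { sound-s   = sound-grow sound-s inc
    ; sound-g   = sound-g
    ; y-agree   = λ L → ≈-trans (y-grow≈0 {s} Δ≈0 L) (y-agree L)
    ; candidate = candidate
    ; ahead     = ahead-grow σ ahead
    }
    where
    open Lag lag
    ahead-grow : ∀ σ → Ahead σ s g → Ahead σ (grow s Δ) g
    ahead-grow (edge _)   ahead = ahead
    ahead-grow (subset _) ahead = ahead

  lag-growʳ : ∀ {σ s g Δ} → Lag σ s g → IsIncrement g Δ → Lag σ s (grow g Δ)
  lag-growʳ {σ} {s} {g} {Δ} lag inc = record
    { sound-s   = sound-s
    ; sound-g   = sound-grow sound-g inc
    ; y-agree   = λ L → ≈-trans (y-agree L) (≈-sym (y-grow L))
    ; candidate = candidate-grow σ candidate
    ; ahead     = ahead-grow σ ahead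
    }
    where
    open Lag lag
    y-grow : ∀ L → y (grow g Δ) L ≈ y g L
    y-grow = y-grow≈0 {g} (candidate⇒increment≈0 sound-g inc (σ , candidate))
    candidate-grow : ∀ σ → Candidate g σ → Candidate (grow g Δ) σ
    candidate-grow (edge _)   (lift (external , tightE)) =
      lift (external-resp {g} {grow g Δ} id external ,
            tightEdge-resp {g} {grow g Δ} (λ L → ≈-sym (y-grow L)) tightE)
    candidate-grow (subset _) (active , tightS) =
      active , tightSubset-resp {g} {grow g Δ} (λ L → ≈-sym (y-grow L)) tightS
    ahead-grow : ∀ σ → Ahead σ s g → Ahead σ s (grow g Δ)
    ahead-grow (edge _)   ahead = ahead
    ahead-grow (subset _) ahead = ahead

  lag-start : ∀ {σ s s′ g} → Similar s g → 𝓑 s ≡ 𝓑 g → Candidate s σ → Processes s σ s′ → Lag σ s′ g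
  lag-start {σ} {s} {s′} {g} sim 𝓑≡ candidate process = record
    { sound-s   = sound-process (soundˡ sim) candidate process
    ; sound-g   = soundʳ sim
    ; y-agree   = λ L → ≈-trans (y-process process L) (y≈ sim L)
    ; candidate = candidate-to sim {σ} candidate
    ; ahead     = ahead process
    }
    where
    y-process : ∀ {σ} → Processes s σ s′ → ∀ L → y s′ L ≈ y s L
    y-process (edge _) _ = ≈-refl
    y-process subset   _ = ≈-refl

    ahead : ∀ {σ} → Processes s σ s′ → Ahead σ s′ g
    ahead process@(edge _) =
      (λ X → mk⇔
        (λ closed → let (closed-s , a⇔b) = to (process-closed process X) closed in
          to (𝓛≋ sim X) closed-s , a⇔b)
        (λ { (closed , a⇔b) → from (process-closed process X) (from (𝓛≋ sim X) closed , a⇔b) })) ,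
      mk⇔ (subst (_ ∈ᶜ_) 𝓑≡) (subst (_ ∈ᶜ_) (sym 𝓑≡))
    ahead (subset {L}) = 𝓛≋ sim , mk⇔ (subst (λ 𝓑 → _ ∈ᶜ L ∷ 𝓑) 𝓑≡) (subst (λ 𝓑 → _ ∈ᶜ L ∷ 𝓑) (sym 𝓑≡))

  module EdgeLag {e : Fin m} {s g : State} (lag : Lag (edge e) s g) where
    open Lag lag

    private
      closed-to : ∀ {X} → Closed (𝓛 s) X → Closed (𝓛 g) X
      closed-to {X} closed = proj₁ (to (proj₁ ahead X) closed)

    -- Sets closed for `s` are closed for `g`, so the partition of `s` is the coarser one.
    external : ∀ {f} → External s f → External g f
    external {f} ext@(L , _ , ends)
      with A , maxA , a∈A ← cover sound-g (source f) | B , maxB , b∈B ← cover sound-g (target f)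
      with A ≟ˢ B
    ... | no A≢B   = external-maximal {g} maxA maxB A≢B a∈A b∈B
    ... | yes refl = contradiction
      (closed-to (maximal-closed (laminar sound-s) maximal₁) A (proj₁ maxA) a∈A source∈ b∈B)
      (external⇒∉member sound-s ext (proj₁ maximal₁) source∈)
      where open Endpoints ends

    module _ {f g′} (f-candidate : Candidate g (edge f)) (process : Processes g (edge f) g′) where
      private
        𝓛-g′ = process-closed process
        sound-g′ = sound-process sound-g f-candidate process

        similar : 𝓛 s ≋ 𝓛 g′ → Processes g (edge f) g′ → Similar s g′
        similar s≋g′ (edge _) = record
          { soundˡ = sound-s
          ; soundʳ = sound-g′
          ; 𝓛≋     = s≋g′
          ; y≈     = y-agree
          ; 𝓑⇔     = λ _ → proj₂ ahead
          }

      catch-up : f ≡ e → Similar s g′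
      catch-up refl = similar
        (λ X → mk⇔ (λ closed → from (𝓛-g′ X) (to (proj₁ ahead X) closed))
                   (λ closed → from (proj₁ ahead X) (to (𝓛-g′ X) closed))) process

      module _ {M} (M∈𝓛 : M ∈ᶜ 𝓛 s) (a∈M : source f ∈ M) (b∈M : target f ∈ M) where
        private
          joined : ∀ X → Closed (𝓛 g′) X → source e ∈ X ⇔ target e ∈ X
          joined X closed with (_ , _ , ends) , _ ← lower f-candidate =
            let (closed-g , f⇔) = to (𝓛-g′ X) closed
            in exchange (laminar sound-g) (proj₁ ahead) M∈𝓛 a∈M b∈M
                 maximal₁ maximal₂ distinct source∈ target∈ X closed-g f⇔
            where open Endpoints ends

        -- `M` shows that `e` already joins the extremes of `f` in `s`; by `exchange`, `f` joins
        -- those of `e` in `g′`. Either edge thus imposes the same condition on closed sets.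
        parallel-similar : Similar s g′
        parallel-similar = similar
          (λ X → mk⇔
            (λ closed → from (𝓛-g′ X) (closed-to closed ,
              mk⇔ (λ a∈X → closed M M∈𝓛 a∈M a∈X b∈M) (λ b∈X → closed M M∈𝓛 b∈M b∈X a∈M)))
            (λ closed → from (proj₁ ahead X) (proj₁ (to (𝓛-g′ X) closed) , joined X closed))) process

        parallel-dead : Dead g′ (edge e)
        parallel-dead with A , maxA , a∈A ← cover sound-g′ (source e) =
          A , proj₁ maxA , a∈A , to (joined A (maximal-closed (laminar sound-g′) maxA)) a∈A

      module _ {s′} (f-external : External s f) (processˡ : Processes s (edge f) s′) where
        private
          -- If `f` joined the extremes of `e` in `g′`, then by `exchange` adding `e` to `g` would
          -- join those of `f`, and `f` would not be external in `s`.
          still-external : External g′ e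
          still-external
            with A , maxA , a∈A ← cover sound-g′ (source e) | B , maxB , b∈B ← cover sound-g′ (target e)
            with A ≟ˢ B
          ... | no A≢B   = external-maximal {g′} maxA maxB A≢B a∈A b∈B
          ... | yes refl =
            let (_ , _ , e-ends) = proj₁ (lower candidate)
                (L , _ , f-ends) = f-external
                module e = Endpoints e-ends
                module f = Endpoints f-ends
                (closed , e⇔) = to (proj₁ ahead L) (maximal-closed (laminar sound-s) f.maximal₁)
            in contradiction
              (to (exchange (laminar sound-g) 𝓛-g′ (proj₁ maxA) a∈A b∈B
                     e.maximal₁ e.maximal₂ e.distinct e.source∈ e.target∈ L closed e⇔) f.source∈)
              (external⇒∉member sound-s f-external (proj₁ f.maximal₁) f.source∈)

          lag′ : Candidate s (edge f) → Processes s (edge f) s′ → Processes g (edge f) g′ → Lag (edge e) s′ g′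
          lag′ candidateˡ p@(edge _) (edge _) = record
            { sound-s   = sound-process sound-s candidateˡ p
            ; sound-g   = sound-g′
            ; y-agree   = y-agree
            ; candidate = lift (still-external , proj₂ (lower candidate))
            ; ahead     = (λ X → mk⇔
                (λ closed → let (closed-s , f⇔) = to (process-closed p X) closed
                                (closed-g , e⇔) = to (proj₁ ahead X) closed-s
                            in from (𝓛-g′ X) (closed-g , f⇔) , e⇔)
                (λ { (closed , e⇔) → let (closed-g , f⇔) = to (𝓛-g′ X) closed in
                  from (process-closed p X) (from (proj₁ ahead X) (closed-g , e⇔) , f⇔) })) , proj₂ ahead
            }

        lag-process : Lag (edge e) s′ g′
        lag-process = lag′ (lift (f-external , tightEdge-resp {g} {s} (λ L → ≈-sym (y-agree L))
          (proj₂ (lower f-candidate)))) processˡ process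

  module SubsetLag {S : Subset n} {s g : State} (lag : Lag (subset S) s g) where
    open Lag lag

    private
      maximal-to′ : ∀ {L} → Maximal (𝓛 s) L → Maximal (𝓛 g) L
      maximal-to′ = maximal-resp (laminar sound-s) (laminar sound-g) (proj₁ ahead)

      maximal-from′ : ∀ {L} → Maximal (𝓛 g) L → Maximal (𝓛 s) L
      maximal-from′ = maximal-resp (laminar sound-g) (laminar sound-s)
        (≋-sym {𝓛 = 𝓛 s} {𝓛 g} (proj₁ ahead))

    𝒴-to : ∀ {f} → 𝒴 s f → 𝒴 g f
    𝒴-to (external , tightE) = external-resp {s} {g} maximal-to′ external , tightEdge-resp {s} {g} y-agree tightE

    𝒴-from : ∀ {f} → 𝒴 g f → 𝒴 s f
    𝒴-from (external , tightE) =
      external-resp {g} {s} maximal-from′ external , tightEdge-resp {g} {s} (λ L → ≈-sym (y-agree L)) tightE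

    𝒵-to : ∀ {L} → 𝒵 s L → 𝒵 g L
    𝒵-to ((max , L∉𝓑) , tightL) =
      (maximal-to′ max , L∉𝓑 ∘ from (proj₂ ahead) ∘ there) , tightSubset-resp {s} {g} y-agree tightL

    𝒵-from : ∀ {L} → L ≢ S → 𝒵 g L → 𝒵 s L
    𝒵-from L≢S ((max , L∉𝓑) , tightL) =
      (maximal-from′ max , λ L∈𝓑 → L∉S∷𝓑 (to (proj₂ ahead) L∈𝓑)) ,
      tightSubset-resp {g} {s} (λ L → ≈-sym (y-agree L)) tightL
      where
      L∉S∷𝓑 : _ ∉ˡ S ∷ 𝓑 g
      L∉S∷𝓑 (here L≡S)  = L≢S L≡S
      L∉S∷𝓑 (there L∈𝓑) = L∉𝓑 L∈𝓑

    catch-up : ∀ {g′} → Processes g (subset S) g′ → Similar s g′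
    catch-up subset = record
      { soundˡ = sound-s
      ; soundʳ = sound-process {σ = subset S} sound-g candidate subset
      ; 𝓛≋     = proj₁ ahead
      ; y≈     = y-agree
      ; 𝓑⇔     = λ _ → proj₂ ahead
      }

    process-subset : ∀ {L s′ g′} → L ≢ S → 𝒵 g L →
                     Processes s (subset L) s′ → Processes g (subset L) g′ → Lag (subset S) s′ g′
    process-subset {L} L≢S L∈𝒵 subset subset = record
      { sound-s   = sound-process {σ = subset L} sound-s (𝒵-from L≢S L∈𝒵) subset
      ; sound-g   = sound-process {σ = subset L} sound-g L∈𝒵 subset
      ; y-agree   = y-agree
      ; candidate = (proj₁ (proj₁ candidate) , λ
          { (here S≡L) → L≢S (sym S≡L) ; (there S∈𝓑) → proj₂ (proj₁ candidate) S∈𝓑 }) , proj₂ candidate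
      ; ahead     = proj₁ ahead , mk⇔
          (λ { (here refl) → there (here refl) ; (there L∈𝓑) → swap (to (proj₂ ahead) L∈𝓑) })
          (λ { (here refl) → there (from (proj₂ ahead) (here refl))
             ; (there (here refl)) → here refl
             ; (there (there L∈𝓑)) → there (from (proj₂ ahead) (there L∈𝓑)) })
      }
      where
      swap : ∀ {X} → X ∈ᶜ S ∷ 𝓑 g → X ∈ᶜ S ∷ L ∷ 𝓑 g
      swap (here refl)  = here refl
      swap (there X∈𝓑) = there (there X∈𝓑)

    -- If `S` stays maximal, it is still pending. If `f` merges it, the blocked collections differ
    -- only at a set that is no longer maximal, which `Similar` ignores.
    process-edge : ∀ {f s′ g′} → 𝒴 g f → Processes s (edge f) s′ → Processes g (edge f) g′ →
                   Lag (subset S) s′ g′ ⊎ (Similar s′ g′ × Dead g′ (subset S))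
    process-edge {f} {s′} {g′} f∈𝒴 p@(edge _) p′@(edge _) = decide (maximal? (𝓛 g′) S)
      where
      sound-s′ = sound-process {σ = edge f} sound-s (lift (𝒴-from f∈𝒴)) p
      sound-g′ = sound-process {σ = edge f} sound-g (lift f∈𝒴) p′

      s′≋g′ : 𝓛 s′ ≋ 𝓛 g′
      s′≋g′ X = mk⇔
        (λ closed → let (closed-s , f⇔) = to (process-closed p X) closed in
          from (process-closed p′ X) (to (proj₁ ahead X) closed-s , f⇔))
        (λ closed → let (closed-g , f⇔) = to (process-closed p′ X) closed in
          from (process-closed p X) (from (proj₁ ahead X) closed-g , f⇔))

      decide : Dec (Maximal (𝓛 g′) S) → Lag (subset S) s′ g′ ⊎ (Similar s′ g′ × Dead g′ (subset S))
      decide (yes max) = inj₁ record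
        { sound-s   = sound-s′
        ; sound-g   = sound-g′
        ; y-agree   = y-agree
        ; candidate = (max , proj₂ (proj₁ candidate)) , proj₂ candidate
        ; ahead     = s′≋g′ , proj₂ ahead
        }
      decide (no ¬max) = inj₂ (record
        { soundˡ = sound-s′
        ; soundʳ = sound-g′
        ; 𝓛≋     = s′≋g′
        ; y≈     = y-agree
        ; 𝓑⇔     = λ max → mk⇔ (λ L∈𝓑 → ∈𝓑-g max (to (proj₂ ahead) L∈𝓑))
                              (λ L∈𝓑 → from (proj₂ ahead) (there L∈𝓑))
        } , there (proj₁ (proj₁ (proj₁ candidate))) , ¬max ∘ proj₁)
        where
        ∈𝓑-g : ∀ {L} → Maximal (𝓛 s′) L → L ∈ᶜ S ∷ 𝓑 g → L ∈ᶜ 𝓑 g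
        ∈𝓑-g max (here refl) =
          contradiction (maximal-resp (laminar sound-s′) (laminar sound-g′) s′≋g′ max) ¬max
        ∈𝓑-g max (there L∈𝓑) = L∈𝓑

  -- Comparison of the two runs

  IsEdge : Item n m → Set
  IsEdge x = ∃ λ e → x ≡ edge e

  -- Here ρ is processed after σ, and ρ′ without σ being enforced: then σ is processed later
  -- on, or never, and in the latter case an edge parallel to σ may be processed instead.
  Outcome : Item n m → List (Item n m) → List (Item n m) → Set
  Outcome σ ρ ρ′ =
    (∀ {x} → x ∈ˡ σ ∷ ρ ⇔ x ∈ˡ ρ′) ⊎
    (σ ∉ˡ ρ′ × (∀ {x} → x ∈ˡ ρ → x ∈ˡ ρ′) × (∀ {x} → x ∈ˡ ρ′ → x ∈ˡ ρ ⊎ (IsEdge σ × IsEdge x)))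

  outcome-∷ : ∀ {σ ρ ρ′} x → σ ≢ x → Outcome σ ρ ρ′ → Outcome σ (x ∷ ρ) (x ∷ ρ′)
  outcome-∷ x _ (inj₁ same) = inj₁ (mk⇔
    (λ { (here refl)         → there (to same (here refl))
       ; (there (here refl)) → here refl
       ; (there (there z∈ρ)) → there (to same (there z∈ρ)) })
    (λ { (here refl)   → there (here refl)
       ; (there z∈ρ′) → swap (from same z∈ρ′) }))
    where
    swap : ∀ {z σ ρ} → z ∈ˡ σ ∷ ρ → z ∈ˡ σ ∷ x ∷ ρ
    swap (here refl) = here refl
    swap (there z∈ρ) = there (there z∈ρ)
  outcome-∷ x σ≢x (inj₂ (σ∉ρ′ , ρ⊆ρ′ , ρ′⊆ρ)) = inj₂
    ( (λ { (here σ≡x) → σ≢x σ≡x ; (there σ∈ρ′) → σ∉ρ′ σ∈ρ′ })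
    , (λ { (here refl) → here refl ; (there z∈ρ) → there (ρ⊆ρ′ z∈ρ) })
    , (λ { (here refl) → inj₁ (here refl) ; (there z∈ρ′) → Sum.map₁ there (ρ′⊆ρ z∈ρ′) }))

  module _ {s₂ g₂ : State} where

    Compared : Item n m → List (Item n m) → List (Item n m) → Set ℓ₁
    Compared σ ρ ρ′ = Outcome σ ρ ρ′ × (∀ L → y s₂ L ≈ y g₂ L)

    𝒴-grow : ∀ {s Δ f} → Δ ≈ 0# → 𝒴 s f → 𝒴 (grow s Δ) f
    𝒴-grow {s} {Δ} Δ≈0 (external , tightE) = external-resp {s} {grow s Δ} id external ,
      tightEdge-resp {s} {grow s Δ} (λ L → ≈-sym (y-grow≈0 {s} Δ≈0 L)) tightE

    mutual
      -- The right run is inspected one step at a time and drives the recursion; the left run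
      -- advances only if it can process the same item. When the right step is solitary, the left
      -- run is kept whole and handed to `similar-runs`.
      lag-runs : ∀ {σ s g ρ ρ′} → Lag σ s g → Run [] s ρ s₂ → Run [] g ρ′ g₂ → Compared σ ρ ρ′
      lag-runs {σ} lag run (return finished) =
        contradiction finished (candidate⇒¬finished (σ , Lag.candidate lag))
      lag-runs {edge e} lag run (iterate _ inc select process run′) =
        edge-lag (lag-growʳ lag inc) run select process run′
      lag-runs {subset S} lag run (iterate _ inc select process run′) =
        subset-lag (lag-growʳ lag inc) run select process run′

      edge-lag : ∀ {e s g x g′ ρ ρ′} → Lag (edge e) s g → Run [] s ρ s₂ →
                 Selects g nothing x → Processes g x g′ → Run [] g′ ρ′ g₂ → Compared (edge e) ρ (x ∷ ρ′)
      edge-lag lag _ (tie-break () _) _ _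
      -- The pending edge is itself in `𝒴 g`, so no subset is selected.
      edge-lag lag _ (firstSubset _ ¬𝒴 _) _ _ = contradiction (_ , lower (Lag.candidate lag)) ¬𝒴
      edge-lag {e} {s} {g} lag run (firstEdge {f} _ f-first) process run′
        with f Fin.≟ e
      ... | yes refl with refl , y≈ ← similar-runs (EdgeLag.catch-up lag (Lag.candidate lag) process refl) run run′
        = inj₁ (mk⇔ id id) , y≈
      ... | no f≢e
        with A , maxA , a∈A ← cover (Lag.sound-s lag) (source f)
           | B , maxB , b∈B ← cover (Lag.sound-s lag) (target f)
        with A ≟ˢ B
      -- In `s` both extremes of `f` lie in one part, merged through `e`; so `f` is parallel to `e`
      -- and is processed in `g` alone.
      ... | yes refl
        with sim ← EdgeLag.parallel-similar lag (lift (proj₁ f-first)) process (proj₁ maxA) a∈A b∈B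
           | dead ← EdgeLag.parallel-dead lag (lift (proj₁ f-first)) process (proj₁ maxA) a∈A b∈B
        with refl , y≈ ← similar-runs sim run run′
        = inj₂ ((λ { (here refl) → f≢e refl ; (there e∈ρ′) → dead⇒∉ (soundʳ sim) run′ dead e∈ρ′ })
               , there
               , (λ { (here refl) → inj₂ ((e , refl) , (f , refl)) ; (there z∈ρ) → inj₁ z∈ρ })) , y≈
      ... | no A≢B = edge-lag-both lag f≢e
        (external-maximal {s} maxA maxB A≢B a∈A b∈B ,
          tightEdge-resp {g} {s} (λ L → ≈-sym (Lag.y-agree lag L)) (proj₂ (proj₁ f-first)))
        run f-first process run′

      edge-lag-both : ∀ {e s g f g′ ρ ρ′} → Lag (edge e) s g → f ≢ e → 𝒴 s f → Run [] s ρ s₂ →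
                      IsFirst _≺ᵉ_ (𝒴 g) f → Processes g (edge f) g′ → Run [] g′ ρ′ g₂ →
                      Compared (edge e) ρ (edge f ∷ ρ′)
      edge-lag-both lag _ f∈𝒴 (return finished) _ _ _ =
        contradiction finished (candidate⇒¬finished (edge _ , lift f∈𝒴))
      edge-lag-both {e} {s} {g} {f} lag f≢e f∈𝒴 (iterate {Δ} _ inc select processˡ run) f-first process run′
        -- Now `f` itself keeps the left increment at zero, so no further edge becomes tight there
        -- and `f` stays first.
        with Δ≈0 ← candidate⇒increment≈0 (Lag.sound-s lag) inc (edge f , lift f∈𝒴)
        with lag′ ← lag-growˡ lag inc Δ≈0 | f∈𝒴′ ← 𝒴-grow {s} {Δ} Δ≈0 f∈𝒴
        with select
      ... | tie-break () _
      ... | firstSubset _ ¬𝒴 _ = contradiction (f , f∈𝒴′) ¬𝒴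
      ... | firstEdge _ x-first
        with refl ← isFirst-unique ≺ᵉ-isStrictTotalOrder x-first f-first
               f∈𝒴′ (EdgeLag.external lag′ (proj₁ (proj₁ x-first)) ,
                     tightEdge-resp {grow s Δ} {g} (Lag.y-agree lag′) (proj₂ (proj₁ x-first)))
        with outcome , y≈ ← lag-runs
               (EdgeLag.lag-process lag′ (lift (proj₁ f-first)) process (proj₁ f∈𝒴′) processˡ) run run′
        = outcome-∷ (edge f) (λ { refl → f≢e refl }) outcome , y≈

      subset-lag : ∀ {S s g x g′ ρ ρ′} → Lag (subset S) s g → Run [] s ρ s₂ →
                   Selects g nothing x → Processes g x g′ → Run [] g′ ρ′ g₂ →
                   Compared (subset S) ρ (x ∷ ρ′)
      subset-lag lag _ (tie-break () _) _ _
      subset-lag lag (return finished) (firstEdge _ (f∈𝒴 , _)) _ _ =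
        contradiction finished (candidate⇒¬finished (edge _ , lift (SubsetLag.𝒴-from lag f∈𝒴)))
      subset-lag {S} lag (iterate _ inc select processˡ run) (firstEdge {f} _ f-first) process run′
        with lag′ ← lag-growˡ lag inc (candidate⇒increment≈0 (Lag.sound-s lag) inc
               (edge f , lift (SubsetLag.𝒴-from lag (proj₁ f-first))))
        with select
      ... | tie-break () _
      ... | firstSubset _ ¬𝒴 _ = contradiction (f , SubsetLag.𝒴-from lag′ (proj₁ f-first)) ¬𝒴
      ... | firstEdge _ x-first
        with refl ← isFirst-unique ≺ᵉ-isStrictTotalOrder x-first f-first
               (SubsetLag.𝒴-from lag′ (proj₁ f-first)) (SubsetLag.𝒴-to lag′ (proj₁ x-first))
        with SubsetLag.process-edge lag′ (proj₁ f-first) processˡ process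
      ... | inj₁ lag″ with outcome , y≈ ← lag-runs lag″ run run′ = outcome-∷ (edge f) (λ ()) outcome , y≈
      -- `S` has been merged without being blocked in the right state, and from here on it is never
      -- processed there.
      ... | inj₂ (sim , dead) with refl , y≈ ← similar-runs sim run run′
        = inj₂ ((λ { (there S∈ρ′) → dead⇒∉ (soundʳ sim) run′ dead S∈ρ′ }) , id , inj₁) , y≈
      subset-lag {S} lag run (firstSubset {L} _ ¬𝒴 L-first) process run′ with L ≟ˢ S
      ... | yes refl with refl , y≈ ← similar-runs (SubsetLag.catch-up lag process) run run′
        = inj₁ (mk⇔ id id) , y≈
      subset-lag {S} {s} lag (return finished) (firstSubset {L} _ _ (L∈𝒵 , _)) _ _ | no L≢S =
        contradiction finished (candidate⇒¬finished {s} (subset L , SubsetLag.𝒵-from lag L≢S L∈𝒵))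
      subset-lag {S} lag (iterate _ inc select processˡ run) (firstSubset {L} _ ¬𝒴 L-first) process run′ | no L≢S
        with lag′ ← lag-growˡ lag inc (candidate⇒increment≈0 (Lag.sound-s lag) inc
               (subset L , SubsetLag.𝒵-from lag L≢S (proj₁ L-first)))
        with select
      ... | tie-break () _
      ... | firstEdge _ (x∈𝒴 , _) = contradiction (_ , SubsetLag.𝒴-to lag′ x∈𝒴) ¬𝒴
      ... | firstSubset _ _ x-first
        with refl ← isFirst-unique ≺ˢ-isStrictTotalOrder x-first L-first
               (SubsetLag.𝒵-from lag′ L≢S (proj₁ L-first)) (SubsetLag.𝒵-to lag′ (proj₁ x-first))
        with outcome , y≈ ← lag-runs
               (SubsetLag.process-subset lag′ L≢S (proj₁ L-first) processˡ process) run run′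
        = outcome-∷ (subset L) (λ { refl → L≢S refl }) outcome , y≈

    𝓑-process : ∀ {s t x s′ t′} → 𝓑 s ≡ 𝓑 t → Processes s x s′ → Processes t x t′ → 𝓑 s′ ≡ 𝓑 t′
    𝓑-process 𝓑≡ (edge _)     (edge _) = 𝓑≡
    𝓑-process 𝓑≡ (subset {L}) subset   = cong (L ∷_) 𝓑≡

    -- Equality of `𝓑` is carried along the common prefix because a lag must start from collections
    -- that agree beyond the maximal sets.
    runs-compared : ∀ τ {σ s g ρ ρ′} → Similar s g → 𝓑 s ≡ 𝓑 g →
                    Run (τ ∷ʳ σ) s (τ ++ σ ∷ ρ) s₂ → Run τ g ρ′ g₂ → Compared σ (τ ++ ρ) ρ′
    runs-compared [] sim _ (iterate ¬finished _ _ _ _) (return finished) =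
      contradiction (finished-to (similar-sym sim) finished) ¬finished
    runs-compared [] {edge e} sim 𝓑≡ (iterate _ inc select process run) (iterate _ inc′ select′ process′ run′) =
      edge-lag (lag-start (similar-grow sim inc inc′) 𝓑≡ (selects⇒candidate select) process)
        run select′ process′ run′
    runs-compared [] {subset S} sim 𝓑≡ (iterate _ inc select process run) (iterate _ inc′ select′ process′ run′) =
      subset-lag (lag-start (similar-grow sim inc inc′) 𝓑≡ (selects⇒candidate select) process)
        run select′ process′ run′
    runs-compared (_ ∷ _) sim _ (iterate ¬finished _ _ _ _) (return finished) =
      contradiction (finished-to (similar-sym sim) finished) ¬finished
    runs-compared (x ∷ τ) {σ} {s} sim 𝓑≡ (iterate _ inc select process run) (iterate _ inc′ select′ process′ run′)
      with grown ← similar-grow sim inc inc′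
      with refl ← selects-unique grown select select′
      with candidate ← selects⇒candidate select
      with sim′ ← similar-process grown candidate process process′
      with outcome , y≈ ← runs-compared τ sim′ (𝓑-process 𝓑≡ process process′) run run′
      -- A prefix item differs from `σ`: once processed it is dead, whereas `σ` is still to come in
      -- the left run.
      = outcome-∷ x (λ { refl → dead⇒∉ (soundˡ sim′) run (processed⇒dead candidate process)
                                  (∈-++⁺ʳ τ (here refl)) }) outcome , y≈

  -- Trees and blocked sets read off the processed sequence

  run-V : ∀ {τ s ρ s′} → Run τ s ρ s′ → V (F s′) ≡ V (F s)
  run-V (return _)                   = refl
  run-V (iterate _ _ _ (edge _) run) = run-V run
  run-V (iterate _ _ _ subset run)   = run-V run

  run-E : ∀ {τ s ρ s′} → Run τ s ρ s′ → ∀ {e} → e ∈ E (F s′) ⇔ (e ∈ E (F s) ⊎ edge e ∈ˡ ρ)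
  run-E (return _) = mk⇔ inj₁ Sum.[ id , (λ ()) ]
  run-E {s = s} (iterate _ _ _ (edge {f} _) run) {e} = mk⇔
    (λ e∈E → Sum.[ Sum.map₂ (here ∘ cong edge ∘ x∈⁅y⁆⇒x≡y f) ∘ x∈p∪q⁻ (E (F s)) ⁅ f ⁆
                 , inj₂ ∘ there ] (to (run-E run) e∈E))
    (λ { (inj₁ e∈E)         → from (run-E run) (inj₁ (p⊆p∪q ⁅ f ⁆ e∈E))
       ; (inj₂ (here refl)) → from (run-E run) (inj₁ (q⊆p∪q (E (F s)) ⁅ f ⁆ (x∈⁅x⁆ f)))
       ; (inj₂ (there e∈ρ)) → from (run-E run) (inj₂ e∈ρ) })
  run-E (iterate _ _ _ subset run) = mk⇔
    (Sum.map₂ there ∘ to (run-E run))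
    (λ { (inj₁ e∈E) → from (run-E run) (inj₁ e∈E) ; (inj₂ (there e∈ρ)) → from (run-E run) (inj₂ e∈ρ) })

  run-𝓑 : ∀ {τ s ρ s′} → Run τ s ρ s′ → ∀ {L} → L ∈ᶜ 𝓑 s′ ⇔ (L ∈ᶜ 𝓑 s ⊎ subset L ∈ˡ ρ)
  run-𝓑 (return _) = mk⇔ inj₁ Sum.[ id , (λ ()) ]
  run-𝓑 (iterate _ _ _ (edge _) run) = mk⇔
    (Sum.map₂ there ∘ to (run-𝓑 run))
    (λ { (inj₁ L∈𝓑) → from (run-𝓑 run) (inj₁ L∈𝓑) ; (inj₂ (there L∈ρ)) → from (run-𝓑 run) (inj₂ L∈ρ) })
  run-𝓑 (iterate _ _ _ subset run) = mk⇔
    (λ L∈𝓑 → Sum.[ (λ { (here refl) → inj₂ (here refl) ; (there L∈𝓑) → inj₁ L∈𝓑 })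
                 , inj₂ ∘ there ] (to (run-𝓑 run) L∈𝓑))
    (λ { (inj₁ L∈𝓑)         → from (run-𝓑 run) (inj₁ (there L∈𝓑))
       ; (inj₂ (here refl)) → from (run-𝓑 run) (inj₁ (here refl))
       ; (inj₂ (there L∈ρ)) → from (run-𝓑 run) (inj₂ L∈ρ) })

  module _ {τ ρ s} (gp : GP τ ρ s) where

    GP-E : ∀ {e} → e ∈ E (F s) ⇔ edge e ∈ˡ ρ
    GP-E = mk⇔ (Sum.[ (λ e∈⊥ → contradiction e∈⊥ ∉⊥) , id ] ∘ to (run-E gp)) (from (run-E gp) ∘ inj₂)

    GP-𝓑 : ∀ {L} → L ∈ᶜ 𝓑 s ⇔ subset L ∈ˡ ρ
    GP-𝓑 = mk⇔ (Sum.[ (λ ()) , id ] ∘ to (run-𝓑 gp)) (from (run-𝓑 gp) ∘ inj₂)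

  module _ {τ τ′ ρ ρ′ s s′} (gp : GP τ ρ s) (gp′ : GP τ′ ρ′ s′) where

    GP-F-≡ : (∀ {e} → edge e ∈ˡ ρ ⇔ edge e ∈ˡ ρ′) → F s ≡ F s′
    GP-F-≡ same = cong₂ mkSubgraph (trans (run-V gp) (sym (run-V gp′))) (⊆-antisym
      (λ e∈E → from (GP-E gp′) (to same (to (GP-E gp) e∈E)))
      (λ e∈E → from (GP-E gp) (from same (to (GP-E gp′) e∈E))))

    GP-𝓑-≐ : (∀ {L} → subset L ∈ˡ ρ ⇔ subset L ∈ˡ ρ′) → 𝓑 s ≐ 𝓑 s′
    GP-𝓑-≐ same = mk⇔ (λ L∈𝓑 → from (GP-𝓑 gp′) (to same (to (GP-𝓑 gp) L∈𝓑)))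
                      (λ L∈𝓑 → from (GP-𝓑 gp) (from same (to (GP-𝓑 gp′) L∈𝓑)))

  -- Pruning phase

  prunable-resp : ∀ {H 𝓒 𝓓} → 𝓒 ≐ 𝓓 → ∃ (Prunable H 𝓒) → ∃ (Prunable H 𝓓)
  prunable-resp 𝓒≐𝓓 (B , B∈𝓒 , single) = B , to 𝓒≐𝓓 B∈𝓒 , single

  -- Runs that process the same items in different orders agree in `𝓑` only as a set; `pick-cong`
  -- makes the pruning choices insensitive to the order.
  PP-unique : ∀ {H 𝓒 𝓓 T T′} → 𝓒 ≐ 𝓓 → PP H 𝓒 T → PP H 𝓓 T′ → T ≡ T′
  PP-unique 𝓒≐𝓓 (return _)       (return _)         = refl
  PP-unique {H} {𝓒} {𝓓} 𝓒≐𝓓 (return ¬∃) (prune prunable _) =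
    contradiction (prunable-resp {H} {𝓓} {𝓒} (mk⇔ (from 𝓒≐𝓓) (to 𝓒≐𝓓)) prunable) ¬∃
  PP-unique {H} {𝓒} {𝓓} 𝓒≐𝓓 (prune prunable _) (return ¬∃) =
    contradiction (prunable-resp {H} {𝓒} {𝓓} 𝓒≐𝓓 prunable) ¬∃
  PP-unique {H} {𝓒} {𝓓} {T} {T′} 𝓒≐𝓓 (prune _ pp) (prune _ pp′) = PP-unique 𝓒≐𝓓 pp
    (subst (λ B → PP (delete B H) 𝓓 T′) (sym (pick-cong H 𝓒≐𝓓)) pp′)

-- Threshold tuples

lemma16 : ∀ {c ℓ₁ ℓ₂} (𝕂 : OrderedField c ℓ₁ ℓ₂) {n m : ℕ} (I : Instance 𝕂 n m)
    (C : Conventions (Instance.graph I)) (potential : OrderedField.Carrier 𝕂) →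
    let open OrderedField 𝕂
        open Algorithm 𝕂 I C potential
    in 0# ≤ potential →
       ∀ (τ̃ : List (Item n m)) (σ : Item n m) → ThresholdTuple τ̃ σ →
       ∀ {ρ ρ′ s s′} → GP (τ̃ ∷ʳ σ) ρ s → GP τ̃ ρ′ s′ →
       (∀ L → y s L ≈ y s′ L)
       × (∀ e → σ ≡ edge e →
            𝓑 s ≐ 𝓑 s′ × e ∉ E (F s′) × F s ⊆ᴳ (F s′ +ᴳ e))
       × (∀ S → σ ≡ subset S →
            F s ≡ F s′ × S ∉ᶜ 𝓑 s′ × 𝓑 s ≐ (S ∷ 𝓑 s′))
lemma16 𝕂 I C potential 0≤potential τ̃ σ threshold {ρ} {ρ′} {s} {s′} gp gp′ = conclude
  where
  open OrderedField 𝕂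
  open Algorithm 𝕂 I C potential
  open Growth 𝕂 I C potential
  open ThresholdTuple threshold using (respected; gw; gw′) renaming (threshold to T̂-vs-T̂′)

  similar₀ : Similar initial initial
  similar₀ = similar-refl (sound-initial 0≤potential)

  -- The threshold tuple brings runs of its own; determinism identifies their sequences with `ρ` and
  -- `ρ′`.
  processed : ∀ {τ ρ₁ ρ₂ s₁ s₂} → GP τ ρ₁ s₁ → GP τ ρ₂ s₂ → ρ₁ ≡ ρ₂
  processed gp₁ gp₂ = proj₁ (similar-runs similar₀ gp₁ gp₂)

  rest : List (Item _ _)
  rest = drop (length (τ̃ ∷ʳ σ)) ρ

  ρ≡ : ρ ≡ τ̃ ++ σ ∷ rest
  ρ≡ with _ , _ , gp₀ , prefix ← respected with refl ← processed gp gp₀ =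
    trans (sym (List.take++drop≡id (length (τ̃ ∷ʳ σ)) ρ))
      (trans (cong (_++ rest) prefix) (List.++-assoc τ̃ _ rest))

  compared : Compared {s} {s′} σ (τ̃ ++ rest) ρ′
  compared = runs-compared τ̃ similar₀ refl (subst (λ ρ → GP (τ̃ ∷ʳ σ) ρ s) ρ≡ gp) gp′

  ρ-members : ∀ {x} → x ∈ˡ ρ ⇔ x ∈ˡ σ ∷ τ̃ ++ rest
  ρ-members = mk⇔
    (λ x∈ρ → ∈-resp-↭ (shift σ τ̃ rest) (subst (_ ∈ˡ_) ρ≡ x∈ρ))
    (λ x∈ → subst (_ ∈ˡ_) (sym ρ≡) (∈-resp-↭ (↭-sym (shift σ τ̃ rest)) x∈))

  ¬same : ¬ (∀ {x} → x ∈ˡ ρ ⇔ x ∈ˡ ρ′)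
  ¬same same with gw | gw′
  ... | _ , s₁ , gp₁ , pp | _ , s₂ , gp₂ , pp′
    with refl ← processed gp gp₁ | refl ← processed gp′ gp₂
    with refl ← PP-unique (GP-𝓑-≐ gp₁ gp₂ same) pp
                  (subst (λ T → PP T (𝓑 s₂) _) (sym (GP-F-≡ gp₁ gp₂ same)) pp′)
    with T̂-vs-T̂′
  ... | inj₁ (k≤T̂ , T̂<k) = ℕ.<⇒≱ T̂<k k≤T̂
  ... | inj₂ (T̂<k , k≤T̂) = ℕ.<⇒≱ T̂<k k≤T̂

  conclude : _
  conclude with compared
  ... | inj₁ same , _ = Empty.⊥-elim
    (¬same (mk⇔ (to same ∘ to ρ-members) (from ρ-members ∘ from same)))
  ... | inj₂ (σ∉ρ′ , ρ⊆ρ′ , ρ′⊆ρ) , y≈ = y≈ , edge-case , subset-case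
    where
    keep : ∀ {x} → x ∈ˡ ρ → x ≢ σ → x ∈ˡ ρ′
    keep x∈ρ x≢σ with to ρ-members x∈ρ
    ... | here x≡σ   = contradiction x≡σ x≢σ
    ... | there x∈   = ρ⊆ρ′ x∈

    edge-case : ∀ e → σ ≡ edge e → 𝓑 s ≐ 𝓑 s′ × e ∉ E (F s′) × F s ⊆ᴳ (F s′ +ᴳ e)
    edge-case e refl = GP-𝓑-≐ gp gp′ (mk⇔ (λ L∈ρ → keep L∈ρ λ ()) subsets-from)
      , (λ e∈E → σ∉ρ′ (to (GP-E gp′) e∈E))
      , (λ v∈V → subst (_ ∈_) (trans (run-V gp) (sym (run-V gp′))) v∈V) , edges-to
      where
      -- Any additional item of the second run is an edge, so it contributes nothing to `𝓑`.
      subsets-from : ∀ {L} → subset L ∈ˡ ρ′ → subset L ∈ˡ ρ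
      subsets-from L∈ρ′ with ρ′⊆ρ L∈ρ′
      ... | inj₁ L∈ρ = from ρ-members (there L∈ρ)
      ... | inj₂ (_ , (_ , ()))

      edges-to : E (F s) ⊆ E (F s′ +ᴳ e)
      edges-to {f} f∈E with f Fin.≟ e
      ... | yes refl = q⊆p∪q (E (F s′)) ⁅ e ⁆ (x∈⁅x⁆ e)
      ... | no f≢e   = p⊆p∪q ⁅ e ⁆ (from (GP-E gp′) (keep (to (GP-E gp) f∈E) λ { refl → f≢e refl }))

    subset-case : ∀ S → σ ≡ subset S → F s ≡ F s′ × S ∉ᶜ 𝓑 s′ × 𝓑 s ≐ (S ∷ 𝓑 s′)
    subset-case S refl = GP-F-≡ gp gp′ (mk⇔ (λ e∈ρ → keep e∈ρ λ ()) back)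
      , (λ S∈𝓑 → σ∉ρ′ (to (GP-𝓑 gp′) S∈𝓑))
      , mk⇔ 𝓑-to (λ { (here refl) → from (GP-𝓑 gp) (from ρ-members (here refl))
                    ; (there L∈𝓑) → from (GP-𝓑 gp) (back (to (GP-𝓑 gp′) L∈𝓑)) })
      where
      -- Additional items occur only if `σ` is an edge.
      back : ∀ {x} → x ∈ˡ ρ′ → x ∈ˡ ρ
      back x∈ρ′ with ρ′⊆ρ x∈ρ′
      ... | inj₁ x∈ρ = from ρ-members (there x∈ρ)
      ... | inj₂ ((_ , ()) , _)

      𝓑-to : ∀ {L} → L ∈ᶜ 𝓑 s → L ∈ᶜ S ∷ 𝓑 s′
      𝓑-to {L} L∈𝓑 with L ≟ˢ S
      ... | yes refl = here refl
      ... | no L≢S   = there (from (GP-𝓑 gp′) (keep (to (GP-𝓑 gp) L∈𝓑) λ { refl → L≢S refl }))
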